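{- Let $r\ge2$ and let $P$ be an arbitrary collectable $r$-pattern. Let $\mathbb{RM}^{(r)}_n$ be an ordered $r$-matching chosen uniformly at random among all $\frac{(rn)!}{(r!)^n n!}$ ordered $r$-matchings on $[rn]$. Then there are constants $0<c\le C$ depending only on $r$ such that, with probability tending to $1$ as $n\to\infty$, the maximum size of a $P$-clique contained in $\mathbb{RM}^{(r)}_n$ lies between $cn^{1/r}$ and $Cn^{1/r}$.
   Context: An ordered $r$-matching on $[rn]$ is a set of $n$ pairwise disjoint $r$-element subsets (edges) of $[rn]$ covering $[rn]$. An $r$-pattern is an ordered $r$-matching of size two, up to order-isomorphism (written as a word in letters $A,B$ each occurring $r$ times). Two edges $e,f$ form pattern $P$ if $\{e,f\}$ with the induced order is order-isomorphic to $P$. A $P$-clique is a matching in which every pair of edges forms $P$; a $P$-clique in a matching $M$ is a sub-matching of $M$ which is a $P$-clique. A pattern $P$ is collectable if for every $k\ge2$ a $P$-clique of size $k$ exists. -}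

module Defs where

open import Data.Nat as ℕ using (ℕ; zero; suc; _*_)
open import Data.Bool using (Bool; true; false; not)
import Data.Bool.Properties as BoolP
open import Data.Fin using (Fin; _≟_)
open import Data.Fin.Properties using (all?)
open import Data.Fin.Subset using (Subset; _∈_; ∣_∣)
open import Data.Fin.Subset.Properties using (_∈?_; anySubset?)
open import Data.Vec as Vec using (Vec; []; _∷_; lookup; count)
open import Data.List as List using (List; []; _∷_; length; filter; concatMap)
import Data.List.Properties as ListP
open import Data.Integer using (+_)
open import Data.Rational using (ℚ; _/_; 1ℚ; 0ℚ; _-_) renaming (_≤_ to _≤ℚ_; _<_ to _<ℚ_; _*_ to _*ℚ_)
import Data.Rational.Properties as ℚP
open import Data.Product using (Σ; ∃; _×_; _,_; proj₁; proj₂)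
open import Data.Empty using (⊥-elim)
open import Data.Sum using (_⊎_; inj₁; inj₂)
open import Relation.Nullary using (¬_; Dec; yes; no)
open import Relation.Nullary.Decidable using (_×-dec_; _⊎-dec_; _→-dec_; ¬?; map′)
open import Relation.Binary.PropositionalEquality using (_≡_; _≢_)

-- Ordered r-matchings on [rn].
-- A matching with n edges on the points 0,…,rn-1 (in their natural
-- order) is presented by an edge-labelling  M : Vec (Fin n) (r * n),
-- point k belonging to edge  lookup M k ; it is an r-matching iff every
-- edge label is used by exactly r points.  Each unlabelled ordered
-- r-matching corresponds to exactly n! labellings (edges are pairwise
-- distinct nonempty sets), so the uniform distribution on labellings
-- induces the uniform distribution on ordered r-matchings.

Labelling : ℕ → ℕ → Set
Labelling r n = Vec (Fin n) (r * n)

IsMatching : ∀ r n → Labelling r n → Set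
IsMatching r n M = ∀ (i : Fin n) → count (_≟ i) M ≡ r

isMatching? : ∀ r n (M : Labelling r n) → Dec (IsMatching r n M)
isMatching? r n M = all? (λ i → count (_≟ i) M ℕ.≟ r)

-- Patterns.  An r-pattern is a word over {A,B} = {true,false} with
-- r letters A (true) and r letters B (false).

occ : Bool → List Bool → ℕ
occ b w = length (filter (BoolP._≟ b) w)

IsRPattern : ℕ → List Bool → Set
IsRPattern r w = (occ true w ≡ r) × (occ false w ≡ r)

pairWord : ∀ {m n} → Vec (Fin n) m → Fin n → Fin n → List Bool
pairWord [] i j = []
pairWord (x ∷ xs) i j with x ≟ i | x ≟ j
... | yes _ | _     = true ∷ pairWord xs i j
... | no _  | yes _ = false ∷ pairWord xs i j
... | no _  | no _  = pairWord xs i j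

-- Edges i, j form pattern P (up to order-isomorphism; the pair {i,j}
-- is unordered, so either letter assignment is allowed).
Forms : ∀ {m n} → List Bool → Vec (Fin n) m → Fin n → Fin n → Set
Forms P M i j = (pairWord M i j ≡ P) ⊎ (pairWord M j i ≡ P)

forms? : ∀ {m n} P (M : Vec (Fin n) m) i j → Dec (Forms P M i j)
forms? P M i j = ListP.≡-dec BoolP._≟_ (pairWord M i j) P
          ⊎-dec ListP.≡-dec BoolP._≟_ (pairWord M j i) P

IsCliqueIn : ∀ {m n} → List Bool → Vec (Fin n) m → Subset n → Set
IsCliqueIn P M S = ∀ i j → i ∈ S → j ∈ S → i ≢ j → Forms P M i j

isCliqueIn? : ∀ {m n} P (M : Vec (Fin n) m) S → Dec (IsCliqueIn P M S)
isCliqueIn? P M S = all? λ i → all? λ j →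
  (i ∈? S) →-dec ((j ∈? S) →-dec (¬? (i ≟ j) →-dec forms? P M i j))

Collectable : ℕ → List Bool → Set
Collectable r P = ∀ k → 2 ℕ.≤ k →
  Σ (Labelling r k) λ M → IsMatching r k M ×
    (∀ i j → i ≢ j → Forms P M i j)

toℚ : ℕ → ℚ
toℚ k = (+ k) / 1

infixr 8 _^ℚ_
_^ℚ_ : ℚ → ℕ → ℚ
q ^ℚ zero  = 1ℚ
q ^ℚ suc k = q *ℚ (q ^ℚ k)

-- The event "the maximum size of a P-clique in M lies between
-- c n^{1/r} and C n^{1/r}", for c, C > 0.  Since the quantities are
-- nonnegative, c n^{1/r} ≤ s  ⇔  c^r n ≤ s^r  and  s ≤ C n^{1/r} ⇔
-- s^r ≤ C^r n.  The maximum ω is ≥ c n^{1/r} iff some P-clique has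
-- size ≥ c n^{1/r}, and ≤ C n^{1/r} iff every P-clique has size
-- ≤ C n^{1/r}.
Good : ∀ r n → List Bool → ℚ → ℚ → Labelling r n → Set
Good r n P c C M =
  (∃ λ S → IsCliqueIn P M S × ((c ^ℚ r) *ℚ toℚ n ≤ℚ toℚ ∣ S ∣ ^ℚ r))
  × (∀ S → IsCliqueIn P M S → toℚ ∣ S ∣ ^ℚ r ≤ℚ (C ^ℚ r) *ℚ toℚ n)

allSubset? : ∀ {n} {Q : Subset n → Set} → (∀ S → Dec (Q S)) → Dec (∀ S → Q S)
allSubset? {n} {Q} Q? with anySubset? (λ S → ¬? (Q? S))
... | yes (S , nq) = no (λ h → nq (h S))
... | no ne = yes λ S → dneg S (λ nq → ne (S , nq))
  where
  dneg : ∀ S → ¬ ¬ Q S → Q S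
  dneg S nn with Q? S
  ... | yes q = q
  ... | no nq = ⊥-elim (nn nq)

good? : ∀ r n P c C (M : Labelling r n) → Dec (Good r n P c C M)
good? r n P c C M =
  anySubset? (λ S → isCliqueIn? P M S ×-dec ((c ^ℚ r) *ℚ toℚ n ℚP.≤? toℚ ∣ S ∣ ^ℚ r))
  ×-dec
  allSubset? (λ S → isCliqueIn? P M S →-dec (toℚ ∣ S ∣ ^ℚ r ℚP.≤? (C ^ℚ r) *ℚ toℚ n))

allVecs : ∀ m n → List (Vec (Fin n) m)
allVecs zero    n = [] ∷ []
allVecs (suc m) n = concatMap (λ v → List.map (_∷ v) (List.allFin n)) (allVecs m n)

-- number of ordered r-matchings on [rn] (as labellings; = n! · (rn)!/((r!)^n n!))
numMatchings : ℕ → ℕ → ℕ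
numMatchings r n = length (filter (isMatching? r n) (allVecs (r * n) n))

numGood : ℕ → ℕ → List Bool → ℚ → ℚ → ℕ
numGood r n P c C =
  length (filter (λ M → isMatching? r n M ×-dec good? r n P c C M) (allVecs (r * n) n))

{-# OPTIONS --safe #-}
-- Upper bound: in a P-clique the order of the first points is a linear order, and the words of
-- all pairs determine how the whole clique is interleaved.  So for a fixed k-tuple of labels
-- only one subword makes it a P-clique listed in this order, while all subwords that are
-- matchings on k labels are equally likely and there are at least (k!)^r of them.  A union bound
-- over n^k tuples, with k^k ≤ 8^k k!, leaves probability at most 2^(-k) once k^r ≥ 16^r n.
--
-- Lower bound: take a large P-clique as a template and blow up each of its points to an interval
-- of [rn].  A label whose r points lie in the r intervals of a template edge hits this edge, and
-- labels hitting distinct template edges form a P-clique, since the intervals are ordered like the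
-- template.  Exposing the labels one at a time, each hits a new template edge with probability
-- of order n^(1/r - 1), as long as linearly many points remain, whence Ω(n^(1/r)) hits.
module Submission where

open import Defs
open import Data.Nat hiding (_≟_; ∣_-_∣)
open import Data.Nat.Properties hiding (_≟_; suc-injective)
import Data.Nat.Properties as ℕP
open import Data.Nat.Combinatorics using (_C_; nCk≡nC[n∸k]; nCn≡1; nC1≡n; nCk+nC[k+1]≡[n+1]C[k+1])
open import Data.Nat.Tactic.RingSolver using (solve-∀)
open import Data.Integer as ℤ using (+[1+_])
import Data.Integer.Properties as ℤP
open import Data.Rational as ℚ using (ℚ; mkℚ; 0ℚ; 1ℚ; _-_; 1/_; toℚᵘ; ↧ₙ_) renaming (_≤_ to _≤ℚ_; _<_ to _<ℚ_; _*_ to _*ℚ_; _+_ to _+ℚ_)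
import Data.Rational.Properties as ℚP
open import Data.Rational.Unnormalised as ℚᵘ using (mkℚᵘ; *≡*; *≤*)
import Data.Rational.Unnormalised.Properties as ℚᵘP
open import Algebra.Bundles using (CommutativeMonoid)
open import Algebra.Properties.CommutativeSemigroup (CommutativeMonoid.commutativeSemigroup ℚP.*-1-commutativeMonoid) using () renaming (interchange to *ℚ-interchange)
open import Data.Bool using (Bool; true; false)
import Data.Bool.Properties as BoolP
open import Data.Fin as Fin using (Fin; zero; suc; _≟_)
open import Data.Fin.Properties as FinP using (suc-injective; all?; any?; ¬∀⟶∃¬)
open import Data.Fin.Subset using (Subset; inside; outside; _∈_; ∣_∣; ⁅_⁆; ⊥) renaming (_-_ to _∖_)
open import Data.Fin.Subset.Properties using (_∈?_; ∉⊥; p─q⊆p; p─⊥≡p; nonempty?; Empty-unique; ∣⊥∣≡0; anySubset?)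
open import Data.Vec as Vec using (Vec; []; _∷_; lookup; count; fromList; toList)
open import Data.Vec.Base using (here; there)
open import Data.Vec.Properties using (length-toList)
open import Data.List as List using (List; []; _∷_; _++_; length; filter; concatMap; allFin; tabulate; replicate)
import Data.List.Properties as ListP
open import Data.List.Properties using (≡-dec; ∷-injectiveˡ; ∷-injectiveʳ)
open import Data.Product using (Σ; ∃; _×_; _,_; proj₁; proj₂; map)
open import Data.Sum using (_⊎_; inj₁; inj₂; [_,_]′)
open import Data.Empty using (⊥-elim)
open import Function using (_∘_; id)
open import Relation.Nullary using (¬_; Dec; yes; no)
open import Relation.Nullary.Decidable using (¬?; _→-dec_; _×-dec_)
open import Relation.Binary.Definitions using (tri<; tri≈; tri>)
open import Relation.Binary.PropositionalEquality

-- Probabilities appear as numbers of words, and every inequality is multiplied out in `ℕ`. The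
-- obstacle in the lower bound is that successive hits are dependent: labels exposed earlier,
-- hitting or not, use up the intervals unevenly, so no single interval can be guaranteed to keep
-- its points. Only the total number of missing points is controlled. If the intervals have nominal
-- size `2 * ℓ` and at most `κ * ℓ` points are missing in all, then at most `κ` template edges
-- contain an interval with fewer than `ℓ` points, whatever the history. As long as `2 * κ` edges
-- are available, the next label thus hits with a conditional probability bounded below uniformly,
-- and induction over the exposed labels bounds an exponential moment of the number of missing hits.
-- Both bad events become exponentially rare in the clique size, so the threshold for `n` depends
-- only on `r` and the denominator of `ε`.

private variable
  A B : Set

-- Finite sums, products and indicators.

∑ : List A → (A → ℕ) → ℕ
∑ []       f = 0
∑ (x ∷ xs) f = f x + ∑ xs f

∏ : (K : ℕ) → (Fin K → ℕ) → ℕ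
∏ zero    f = 1
∏ (suc K) f = f zero * ∏ K (f ∘ suc)

ind : {P : Set} → Dec P → ℕ
ind (yes _) = 1
ind (no _)  = 0

ind≤1 : {P : Set} (d : Dec P) → ind d ≤ 1
ind≤1 (yes _) = ≤-refl
ind≤1 (no _)  = z≤n

ind-yes : {P : Set} (d : Dec P) → P → ind d ≡ 1
ind-yes (yes _) p = refl
ind-yes (no ¬p) p = ⊥-elim (¬p p)

ind-no : {P : Set} (d : Dec P) → ¬ P → ind d ≡ 0
ind-no (yes p) ¬p = ⊥-elim (¬p p)
ind-no (no _)  ¬p = refl

ind≢0 : {P : Set} (d : Dec P) → ind d ≢ 0 → P
ind≢0 (yes p) _ = p
ind≢0 (no _)  h = ⊥-elim (h refl)

ind-mono : {P Q : Set} (d : Dec P) (e : Dec Q) → (P → Q) → ind d ≤ ind e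
ind-mono (yes p) e h = ≤-reflexive (sym (ind-yes e (h p)))
ind-mono (no _)  e h = z≤n

ind-cong : {P Q : Set} (d : Dec P) (e : Dec Q) → (P → Q) → (Q → P) → ind d ≡ ind e
ind-cong d e f g = ≤-antisym (ind-mono d e f) (ind-mono e d g)

∑-mono : (xs : List A) {f g : A → ℕ} → (∀ x → f x ≤ g x) → ∑ xs f ≤ ∑ xs g
∑-mono []       h = z≤n
∑-mono (x ∷ xs) h = +-mono-≤ (h x) (∑-mono xs h)

∑-cong : (xs : List A) {f g : A → ℕ} → (∀ x → f x ≡ g x) → ∑ xs f ≡ ∑ xs g
∑-cong []       h = refl
∑-cong (x ∷ xs) h = cong₂ _+_ (h x) (∑-cong xs h)

∑-+ : (xs : List A) (f g : A → ℕ) → ∑ xs (λ x → f x + g x) ≡ ∑ xs f + ∑ xs g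
∑-+ []       f g = refl
∑-+ (x ∷ xs) f g = trans (cong (f x + g x +_) (∑-+ xs f g))
                         (interchange (f x) (g x) (∑ xs f) (∑ xs g))
  where
  interchange : ∀ a b c d → a + b + (c + d) ≡ a + c + (b + d)
  interchange = solve-∀

∑-*ˡ : (xs : List A) (c : ℕ) (f : A → ℕ) → ∑ xs (λ x → c * f x) ≡ c * ∑ xs f
∑-*ˡ []       c f = sym (*-zeroʳ c)
∑-*ˡ (x ∷ xs) c f = trans (cong (c * f x +_) (∑-*ˡ xs c f)) (sym (*-distribˡ-+ c (f x) _))

∑-*ʳ : (xs : List A) (c : ℕ) (f : A → ℕ) → ∑ xs (λ x → f x * c) ≡ ∑ xs f * c
∑-*ʳ xs c f = trans (∑-cong xs (λ x → *-comm (f x) c)) (trans (∑-*ˡ xs c f) (*-comm c _))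

∑-const : (xs : List A) (c : ℕ) → ∑ xs (λ _ → c) ≡ length xs * c
∑-const []       c = refl
∑-const (x ∷ xs) c = cong (c +_) (∑-const xs c)

∑-0 : (xs : List A) {f : A → ℕ} → (∀ x → f x ≡ 0) → ∑ xs f ≡ 0
∑-0 xs h = trans (∑-cong xs h) (trans (∑-const xs 0) (*-zeroʳ (length xs)))

∑-swap : (xs : List A) (ys : List B) (f : A → B → ℕ) →
  ∑ xs (λ x → ∑ ys (f x)) ≡ ∑ ys (λ y → ∑ xs (λ x → f x y))
∑-swap []       ys f = sym (∑-0 ys (λ _ → refl))
∑-swap (x ∷ xs) ys f = trans (cong (∑ ys (f x) +_) (∑-swap xs ys f)) (sym (∑-+ ys (f x) _))

∑-++ : (xs ys : List A) (f : A → ℕ) → ∑ (xs ++ ys) f ≡ ∑ xs f + ∑ ys f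
∑-++ []       ys f = refl
∑-++ (x ∷ xs) ys f = trans (cong (f x +_) (∑-++ xs ys f)) (sym (+-assoc (f x) _ _))

∑-map : (h : A → B) (xs : List A) (f : B → ℕ) → ∑ (List.map h xs) f ≡ ∑ xs (f ∘ h)
∑-map h []       f = refl
∑-map h (x ∷ xs) f = cong (f (h x) +_) (∑-map h xs f)

∑-concatMap : (h : A → List B) (xs : List A) (f : B → ℕ) →
  ∑ (concatMap h xs) f ≡ ∑ xs (λ x → ∑ (h x) f)
∑-concatMap h []       f = refl
∑-concatMap h (x ∷ xs) f = trans (∑-++ (h x) _ f) (cong (∑ (h x) f +_) (∑-concatMap h xs f))

-- A constructive case split: a count either vanishes, which makes a bound on it trivial, or
-- supplies a concrete object to argue with.
∑-zero-or-witness : (xs : List A) (f : A → ℕ) → ∑ xs f ≡ 0 ⊎ ∃ λ x → f x ≢ 0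
∑-zero-or-witness []       f = inj₁ refl
∑-zero-or-witness (x ∷ xs) f with f x in eq | ∑-zero-or-witness xs f
... | suc _ | _      = inj₂ (x , λ e → 1+n≢0 (trans (sym eq) e))
... | zero  | inj₁ e = inj₁ e
... | zero  | inj₂ w = inj₂ w

length-filter : {P : A → Set} (P? : ∀ x → Dec (P x)) (xs : List A) →
  length (filter P? xs) ≡ ∑ xs (λ x → ind (P? x))
length-filter P? []       = refl
length-filter P? (x ∷ xs) with P? x
... | yes _ = cong suc (length-filter P? xs)
... | no _  = length-filter P? xs

∑-tabulate : ∀ {n} (h : Fin n → A) (f : A → ℕ) → ∑ (tabulate h) f ≡ ∑ (allFin n) (f ∘ h)
∑-tabulate {n = n} h f = trans (cong (λ xs → ∑ xs f) (sym (ListP.map-tabulate id h))) (∑-map h (allFin n) f)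

∑-allFin-suc : ∀ {n} (f : Fin (suc n) → ℕ) → ∑ (allFin (suc n)) f ≡ f zero + ∑ (allFin n) (f ∘ suc)
∑-allFin-suc f = cong (f zero +_) (∑-tabulate suc f)

∑-allVecs-suc : ∀ {m n} (f : Vec (Fin n) (suc m) → ℕ) →
  ∑ (allVecs (suc m) n) f ≡ ∑ (allVecs m n) (λ v → ∑ (allFin n) (λ x → f (x ∷ v)))
∑-allVecs-suc {m} {n} f = trans (∑-concatMap _ (allVecs m n) f)
  (∑-cong (allVecs m n) (λ v → ∑-map (_∷ v) (allFin n) f))

length-allVecs : ∀ m n → ∑ (allVecs m n) (λ _ → 1) ≡ n ^ m
length-allVecs zero    n = refl
length-allVecs (suc m) n = trans (∑-allVecs-suc {m} {n} (λ _ → 1)) (trans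
  (∑-cong (allVecs m n) {g = λ _ → n * 1} (λ _ → trans (∑-const (allFin n) 1)
     (cong (_* 1) (ListP.length-tabulate {n = n} id))))
  (trans (∑-*ˡ (allVecs m n) n (λ _ → 1)) (cong (n *_) (length-allVecs m n))))

δ : ∀ {n} → Fin n → Fin n → ℕ
δ x y = ind (x ≟ y)

δ-refl : ∀ {n} (x : Fin n) → δ x x ≡ 1
δ-refl x = ind-yes (x ≟ x) refl

δ-≢ : ∀ {n} {x y : Fin n} → x ≢ y → δ x y ≡ 0
δ-≢ {x = x} {y} = ind-no (x ≟ y)

δ≢0⇒≡ : ∀ {n} {x y : Fin n} → δ x y ≢ 0 → x ≡ y
δ≢0⇒≡ {x = x} {y} = ind≢0 (x ≟ y)

δ-sym : ∀ {n} (x y : Fin n) → δ x y ≡ δ y x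
δ-sym x y = ind-cong (x ≟ y) (y ≟ x) sym sym

δ-suc : ∀ {n} (x y : Fin n) → δ (suc x) (suc y) ≡ δ x y
δ-suc x y = ind-cong (suc x ≟ suc y) (x ≟ y) suc-injective (cong suc)

∑-δ : ∀ {n} (y : Fin n) → ∑ (allFin n) (δ y) ≡ 1
∑-δ {suc n} zero = trans (∑-allFin-suc {n} (δ zero)) (cong suc (∑-0 (allFin n) (λ _ → refl)))
∑-δ {suc n} (suc y) = trans (∑-allFin-suc (δ (suc y)))
  (trans (∑-cong (allFin n) (λ x → δ-suc y x)) (∑-δ y))

term≤∑ : ∀ {n} (f : Fin n → ℕ) (x : Fin n) → f x ≤ ∑ (allFin n) f
term≤∑ f zero    = ≤-trans (m≤m+n _ _) (≤-reflexive (sym (∑-allFin-suc f)))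
term≤∑ f (suc x) = ≤-trans (term≤∑ (f ∘ suc) x)
  (≤-trans (m≤n+m _ (f zero)) (≤-reflexive (sym (∑-allFin-suc f))))

∑-unique≤1 : ∀ {n} (f : Fin n → ℕ) → (∀ x → f x ≤ 1) →
  (∀ x y → f x ≢ 0 → f y ≢ 0 → x ≡ y) → ∑ (allFin n) f ≤ 1
∑-unique≤1 {n} f f≤1 uniq with ∑-zero-or-witness (allFin n) f
... | inj₁ e = ≤-trans (≤-reflexive e) z≤n
... | inj₂ (x , fx≢0) = ≤-trans (∑-mono (allFin n) f≤δ) (≤-reflexive (∑-δ x))
  where
  f≤δ : ∀ y → f y ≤ δ x y
  f≤δ y with f y in eq
  ... | zero  = z≤n
  ... | suc _ = ≤-trans (subst (_≤ 1) eq (f≤1 y)) (≤-reflexive (sym (ind-yes (x ≟ y)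
                  (uniq x y fx≢0 (λ e → 1+n≢0 (trans (sym eq) e))))))

∏-cong : ∀ K {f g : Fin K → ℕ} → (∀ p → f p ≡ g p) → ∏ K f ≡ ∏ K g
∏-cong zero    h = refl
∏-cong (suc K) h = cong₂ _*_ (h zero) (∏-cong K (h ∘ suc))

∏-mono : ∀ K {f g : Fin K → ℕ} → (∀ p → f p ≤ g p) → ∏ K f ≤ ∏ K g
∏-mono zero    h = ≤-refl
∏-mono (suc K) h = *-mono-≤ (h zero) (∏-mono K (h ∘ suc))

∏-^ : ∀ K (x : ℕ) (e : Fin K → ℕ) → ∏ K (λ p → x ^ e p) ≡ x ^ ∑ (allFin K) e
∏-^ zero    x e = refl
∏-^ (suc K) x e = trans (cong (x ^ e zero *_) (∏-^ K x (e ∘ suc)))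
  (trans (sym (^-distribˡ-+-* x (e zero) _)) (cong (x ^_) (sym (∑-allFin-suc e))))

∏≢0⇒ : ∀ K (f : Fin K → ℕ) → ∏ K f ≢ 0 → ∀ p → f p ≢ 0
∏≢0⇒ (suc K) f h zero    e = h (cong (_* ∏ K (f ∘ suc)) e)
∏≢0⇒ (suc K) f h (suc p) e =
  ∏≢0⇒ K (f ∘ suc) (λ e′ → h (trans (cong (f zero *_) e′) (*-zeroʳ (f zero)))) p e

∏≤1 : ∀ K (f : Fin K → ℕ) → (∀ p → f p ≤ 1) → ∏ K f ≤ 1
∏≤1 zero    f h = ≤-refl
∏≤1 (suc K) f h = *-mono-≤ (h zero) (∏≤1 K (f ∘ suc) (h ∘ suc))

-- A product is linear in each factor separately. For sums over masks, including or excluding one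
-- point affects only the factor of the interval `c` that contains it.
∏-additive : ∀ K (c : Fin K) {f g h : Fin K → ℕ} →
  (∀ p → p ≢ c → f p ≡ g p × f p ≡ h p) → f c ≡ g c + h c → ∏ K f ≡ ∏ K g + ∏ K h
∏-additive (suc K) zero {f} {g} {h} off at = begin
  f zero * ∏ K (f ∘ suc)                              ≡⟨ cong (_* ∏ K (f ∘ suc)) at ⟩
  (g zero + h zero) * ∏ K (f ∘ suc)                   ≡⟨ *-distribʳ-+ (∏ K (f ∘ suc)) (g zero) _ ⟩
  g zero * ∏ K (f ∘ suc) + h zero * ∏ K (f ∘ suc)     ≡⟨ cong₂ (λ a b → g zero * a + h zero * b)
     (∏-cong K (λ p → proj₁ (off (suc p) λ ()))) (∏-cong K (λ p → proj₂ (off (suc p) λ ()))) ⟩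
  g zero * ∏ K (g ∘ suc) + h zero * ∏ K (h ∘ suc)     ∎
  where open ≡-Reasoning
∏-additive (suc K) (suc c) {f} {g} {h} off at = begin
  f zero * ∏ K (f ∘ suc)                          ≡⟨ cong (f zero *_) (∏-additive K c
     (λ p p≢c → off (suc p) (λ e → p≢c (suc-injective e))) at) ⟩
  f zero * (∏ K (g ∘ suc) + ∏ K (h ∘ suc))        ≡⟨ *-distribˡ-+ (f zero) (∏ K (g ∘ suc)) _ ⟩
  f zero * ∏ K (g ∘ suc) + f zero * ∏ K (h ∘ suc) ≡⟨ cong₂ (λ a b → a * ∏ K (g ∘ suc) + b * ∏ K (h ∘ suc))
     (proj₁ (off zero λ ())) (proj₂ (off zero λ ())) ⟩
  g zero * ∏ K (g ∘ suc) + h zero * ∏ K (h ∘ suc) ∎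
  where open ≡-Reasoning

vec-term≤∑ : ∀ {m n} (f : Vec (Fin n) m → ℕ) (v : Vec (Fin n) m) → f v ≤ ∑ (allVecs m n) f
vec-term≤∑ f []      = m≤m+n (f []) 0
vec-term≤∑ {suc m} {n} f (x ∷ v) = ≤-trans (term≤∑ (λ x → f (x ∷ v)) x)
  (≤-trans (vec-term≤∑ (λ v → ∑ (allFin n) (λ x → f (x ∷ v))) v) (≤-reflexive (sym (∑-allVecs-suc f))))

-- Peeling off the edge with label zero

multiplicity : ∀ {m n} → Vec (Fin n) m → Fin n → ℕ
multiplicity []      i = 0
multiplicity (x ∷ v) i = δ x i + multiplicity v i

count≡multiplicity : ∀ {m n} (v : Vec (Fin n) m) (i : Fin n) → count (_≟ i) v ≡ multiplicity v i
count≡multiplicity []      i = refl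
count≡multiplicity (x ∷ v) i with x ≟ i
... | yes _ = cong suc (count≡multiplicity v i)
... | no _  = count≡multiplicity v i

∑-multiplicity : ∀ {m n} (v : Vec (Fin n) m) → ∑ (allFin n) (multiplicity v) ≡ m
∑-multiplicity {n = n} []      = ∑-0 (allFin n) (λ _ → refl)
∑-multiplicity {n = n} (x ∷ v) = trans (∑-+ (allFin n) (δ x) (multiplicity v))
  (cong₂ _+_ (∑-δ x) (∑-multiplicity v))

occurs : ∀ {m n} (v : Vec (Fin n) m) (i : Fin n) → multiplicity v i ≢ 0 → ∃ λ p → lookup v p ≡ i
occurs []      i h = ⊥-elim (h refl)
occurs (x ∷ v) i h with x ≟ i
... | yes e = zero , e
... | no _  = map suc id (occurs v i h)

-- The length `m` is left free, unlike in `IsMatching`: peeling off a label leaves a word of length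
-- `falses b`, which is `n * r` only propositionally.
Matching : ∀ {m n} → ℕ → Vec (Fin n) m → Set
Matching r v = ∀ i → multiplicity v i ≡ r

matching? : ∀ {m n} r (v : Vec (Fin n) m) → Dec (Matching r v)
matching? r v = all? (λ i → multiplicity v i ℕP.≟ r)

toMatching : ∀ {r n} {M : Labelling r n} → IsMatching r n M → Matching r M
toMatching {M = M} h i = trans (sym (count≡multiplicity M i)) (h i)

fromMatching : ∀ {r n} {M : Labelling r n} → Matching r M → IsMatching r n M
fromMatching {M = M} h i = trans (count≡multiplicity M i) (h i)

matching-size : ∀ {r m n} (v : Vec (Fin n) m) → Matching r v → m ≡ n * r
matching-size {r} {m} {n} v h = trans (sym (∑-multiplicity v))
  (trans (∑-cong (allFin n) h) (trans (∑-const (allFin n) r) (cong (_* r) (ListP.length-tabulate {n = n} id))))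

masks : (m : ℕ) → List (Vec Bool m)
masks zero    = [] ∷ []
masks (suc m) = concatMap (λ b → (true ∷ b) ∷ (false ∷ b) ∷ []) (masks m)

trues : ∀ {m} → Vec Bool m → ℕ
trues []          = 0
trues (true ∷ b)  = suc (trues b)
trues (false ∷ b) = trues b

falses : ∀ {m} → Vec Bool m → ℕ
falses []          = 0
falses (true ∷ b)  = falses b
falses (false ∷ b) = suc (falses b)

trues+falses : ∀ {m} (b : Vec Bool m) → trues b + falses b ≡ m
trues+falses []          = refl
trues+falses (true ∷ b)  = cong suc (trues+falses b)
trues+falses (false ∷ b) = trans (+-suc (trues b) (falses b)) (cong suc (trues+falses b))

∑-masks-suc : ∀ m (f : Vec Bool (suc m) → ℕ) →
  ∑ (masks (suc m)) f ≡ ∑ (masks m) (λ b → f (true ∷ b) + f (false ∷ b))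
∑-masks-suc m f = trans (∑-concatMap _ (masks m) f)
  (∑-cong (masks m) (λ b → cong (f (true ∷ b) +_) (+-identityʳ _)))

merge : ∀ {m n} (b : Vec Bool m) → Vec (Fin n) (falses b) → Vec (Fin (suc n)) m
merge []          w       = []
merge (true ∷ b)  w       = zero ∷ merge b w
merge (false ∷ b) (x ∷ w) = suc x ∷ merge b w

-- Every word over `suc n` letters is `merge b w` for exactly one pair: `b` marks the zeros, and `w`
-- lists the other letters lowered by one. Both the counting of matchings and the exposure of labels
-- rest on this decomposition.
∑-merge : ∀ m n (f : Vec (Fin (suc n)) m → ℕ) →
  ∑ (allVecs m (suc n)) f ≡ ∑ (masks m) (λ b → ∑ (allVecs (falses b) n) (λ w → f (merge b w)))
∑-merge zero    n f = sym (+-identityʳ _)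
∑-merge (suc m) n f = begin
  ∑ (allVecs (suc m) (suc n)) f
    ≡⟨ ∑-allVecs-suc f ⟩
  ∑ (allVecs m (suc n)) (λ v → ∑ (allFin (suc n)) (λ x → f (x ∷ v)))
    ≡⟨ ∑-merge m n _ ⟩
  ∑ (masks m) (λ b → ∑ (allVecs (falses b) n) (λ w → ∑ (allFin (suc n)) (λ x → f (x ∷ merge b w))))
    ≡⟨ ∑-cong (masks m) (λ b → trans
         (∑-cong (allVecs (falses b) n) (λ w → ∑-allFin-suc (λ x → f (x ∷ merge b w))))
         (∑-+ (allVecs (falses b) n) _ _)) ⟩
  ∑ (masks m) (λ b → ∑ (allVecs (falses b) n) (λ w → f (zero ∷ merge b w))
                   + ∑ (allVecs (falses b) n) (λ w → ∑ (allFin n) (λ x → f (suc x ∷ merge b w))))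
    ≡⟨ ∑-cong (masks m) (λ b → cong (∑ (allVecs (falses b) n) (λ w → f (zero ∷ merge b w)) +_)
         (sym (∑-allVecs-suc (λ w → f (merge (false ∷ b) w))))) ⟩
  ∑ (masks m) (λ b → ∑ (allVecs (falses b) n) (λ w → f (zero ∷ merge b w))
                   + ∑ (allVecs (suc (falses b)) n) (λ w → f (merge (false ∷ b) w)))
    ≡⟨ sym (∑-masks-suc m _) ⟩
  ∑ (masks (suc m)) (λ b → ∑ (allVecs (falses b) n) (λ w → f (merge b w))) ∎
  where open ≡-Reasoning

multiplicity-merge-zero : ∀ {m n} (b : Vec Bool m) (w : Vec (Fin n) (falses b)) →
  multiplicity (merge b w) zero ≡ trues b
multiplicity-merge-zero []          w       = refl
multiplicity-merge-zero (true ∷ b)  w       = cong suc (multiplicity-merge-zero b w)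
multiplicity-merge-zero (false ∷ b) (x ∷ w) = multiplicity-merge-zero b w

multiplicity-merge-suc : ∀ {m n} (b : Vec Bool m) (w : Vec (Fin n) (falses b)) (i : Fin n) →
  multiplicity (merge b w) (suc i) ≡ multiplicity w i
multiplicity-merge-suc []          []      i = refl
multiplicity-merge-suc (true ∷ b)  w       i = multiplicity-merge-suc b w i
multiplicity-merge-suc (false ∷ b) (x ∷ w) i = cong₂ _+_ (δ-suc x i) (multiplicity-merge-suc b w i)

merge-matching⁻ : ∀ {r m n} (b : Vec Bool m) (w : Vec (Fin n) (falses b)) →
  Matching r (merge b w) → trues b ≡ r × Matching r w
merge-matching⁻ b w h =
  trans (sym (multiplicity-merge-zero b w)) (h zero) ,
  λ i → trans (sym (multiplicity-merge-suc b w i)) (h (suc i))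

merge-matching⁺ : ∀ {r m n} (b : Vec Bool m) (w : Vec (Fin n) (falses b)) →
  trues b ≡ r → Matching r w → Matching r (merge b w)
merge-matching⁺ b w e h zero    = trans (multiplicity-merge-zero b w) e
merge-matching⁺ b w e h (suc i) = trans (multiplicity-merge-suc b w i) (h i)

-- The sum of h(|S|) over all subsets S of an n-element set.
∑-subsets : (ℕ → ℕ) → ℕ → ℕ
∑-subsets h zero    = h 0
∑-subsets h (suc n) = ∑-subsets (h ∘ suc) n + ∑-subsets h n

nC0≡1 : ∀ n → n C 0 ≡ 1
nC0≡1 n = trans (nCk≡nC[n∸k] {0} {n} z≤n) (nCn≡1 n)

-- Sorting subsets by whether they contain a given element is Pascal's rule. The helper `go` takes
-- `h` up to pointwise equality, since its shift by `suc` is an indicator only extensionally.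
∑-subsets-C : ∀ n t → ∑-subsets (λ x → ind (x ℕP.≟ t)) n ≡ n C t
∑-subsets-C n t = go n t (λ x → ind (x ℕP.≟ t)) (λ _ → refl)
  where
  ∑-subsets-0 : ∀ n h → (∀ x → h x ≡ 0) → ∑-subsets h n ≡ 0
  ∑-subsets-0 zero    h e = e 0
  ∑-subsets-0 (suc n) h e = cong₂ _+_ (∑-subsets-0 n (h ∘ suc) (e ∘ suc)) (∑-subsets-0 n h e)

  go : ∀ n t h → (∀ x → h x ≡ ind (x ℕP.≟ t)) → ∑-subsets h n ≡ n C t
  go zero    zero    h e = e 0
  go zero    (suc t) h e = e 0
  go (suc n) zero    h e = cong₂ _+_ (∑-subsets-0 n (h ∘ suc) (λ x → e (suc x))) (trans (go n zero h e) (nC0≡1 n))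
  go (suc n) (suc t) h e = trans (cong₂ _+_
    (go n t (h ∘ suc) (λ x → trans (e (suc x)) (ind-cong (suc x ℕP.≟ suc t) (x ℕP.≟ t) ℕP.suc-injective (cong suc))))
    (go n (suc t) h e)) (nCk+nC[k+1]≡[n+1]C[k+1] n t)

∑-masks-trues : ∀ m h → ∑ (masks m) (λ b → h (trues b)) ≡ ∑-subsets h m
∑-masks-trues zero    h = +-identityʳ _
∑-masks-trues (suc m) h = trans (∑-masks-suc m (h ∘ trues)) (trans (∑-+ (masks m) _ _)
  (cong₂ _+_ (∑-masks-trues m (h ∘ suc)) (∑-masks-trues m h)))

∑-masks-C : ∀ m r → ∑ (masks m) (λ b → ind (trues b ℕP.≟ r)) ≡ m C r
∑-masks-C m r = trans (∑-masks-trues m (λ x → ind (x ℕP.≟ r))) (∑-subsets-C m r)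

-- The multinomial coefficient `(n * r)! / (r !)^n`, in the form that peeling off label zero
-- produces.
matchings# : ℕ → ℕ → ℕ
matchings# r zero    = 1
matchings# r (suc n) = ((suc n * r) C r) * matchings# r n

peel-size : ∀ {r m} n (b : Vec Bool m) → m ≡ suc n * r → trues b ≡ r → falses b ≡ n * r
peel-size {r} n b e t = +-cancelˡ-≡ r _ _
  (trans (cong (_+ falses b) (sym t)) (trans (trues+falses b) e))

∑-matching : ∀ {r m} n → m ≡ n * r → ∑ (allVecs m n) (λ v → ind (matching? r v)) ≡ matchings# r n
∑-matching zero refl = refl
∑-matching {r} {m} (suc n) e = begin
  ∑ (allVecs m (suc n)) (λ v → ind (matching? r v))
    ≡⟨ ∑-merge m n _ ⟩
  ∑ (masks m) (λ b → ∑ (allVecs (falses b) n) (λ w → ind (matching? r (merge b w))))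
    ≡⟨ ∑-cong (masks m) peel ⟩
  ∑ (masks m) (λ b → ind (trues b ℕP.≟ r) * matchings# r n)
    ≡⟨ ∑-*ʳ (masks m) (matchings# r n) _ ⟩
  ∑ (masks m) (λ b → ind (trues b ℕP.≟ r)) * matchings# r n
    ≡⟨ cong (_* matchings# r n) (trans (∑-masks-C m r) (cong (_C r) e)) ⟩
  ((suc n * r) C r) * matchings# r n ∎
  where
  open ≡-Reasoning
  peel : ∀ b → ∑ (allVecs (falses b) n) (λ w → ind (matching? r (merge b w)))
             ≡ ind (trues b ℕP.≟ r) * matchings# r n
  peel b with trues b ℕP.≟ r
  ... | yes t = trans (∑-cong (allVecs (falses b) n) (λ w → ind-cong (matching? r (merge b w)) (matching? r w)
                        (proj₂ ∘ merge-matching⁻ b w) (merge-matching⁺ b w t)))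
                  (trans (∑-matching n (peel-size n b e t)) (sym (+-identityʳ _)))
  ... | no ¬t = ∑-0 (allVecs (falses b) n) (λ w → ind-no (matching? r (merge b w)) (¬t ∘ proj₁ ∘ merge-matching⁻ b w))

numMatchings≡ : ∀ r n → numMatchings r n ≡ matchings# r n
numMatchings≡ r n = trans (length-filter (isMatching? r n) (allVecs (r * n) n))
  (trans (∑-cong (allVecs (r * n) n) (λ M → ind-cong (isMatching? r n M) (matching? r M) (toMatching {M = M}) (fromMatching {M = M})))
    (∑-matching n (*-comm r n)))

-- Binomial and exponential estimates

C-suc : ∀ n k → suc n C suc k ≡ n C k + n C suc k
C-suc n k = sym (nCk+nC[k+1]≡[n+1]C[k+1] n k)

C-mono : ∀ n k → n C k ≤ suc n C k
C-mono n zero    = ≤-reflexive (trans (nC0≡1 n) (sym (nC0≡1 (suc n))))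
C-mono n (suc k) = ≤-trans (m≤n+m _ (n C k)) (≤-reflexive (sym (C-suc n k)))

C≤^ : ∀ n k → n C k ≤ n ^ k
C≤^ n       zero    = ≤-reflexive (nC0≡1 n)
C≤^ zero    (suc k) = z≤n
C≤^ (suc n) (suc k) = begin
  suc n C suc k          ≡⟨ C-suc n k ⟩
  n C k + n C suc k      ≤⟨ +-mono-≤ (C≤^ n k) (C≤^ n (suc k)) ⟩
  suc n * n ^ k          ≤⟨ *-monoʳ-≤ (suc n) (^-monoˡ-≤ k (n≤1+n n)) ⟩
  suc n ^ suc k          ∎
  where open ≤-Reasoning

-- The left side counts those subsets on the right that have exactly one element among the last `a`.
C-step : ∀ a n j → a * (n C j) ≤ (n + a) C suc j
C-step zero    n j = z≤n
C-step (suc a) n j = begin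
  n C j + a * (n C j)                ≤⟨ +-mono-≤ (C-mono* a) (C-step a n j) ⟩
  (n + a) C j + (n + a) C suc j      ≡⟨ C-suc (n + a) j ⟨
  suc (n + a) C suc j                ≡⟨ cong (_C suc j) (+-suc n a) ⟨
  (n + suc a) C suc j                ∎
  where
  open ≤-Reasoning
  C-mono* : ∀ a → n C j ≤ (n + a) C j
  C-mono* zero    = ≤-reflexive (cong (_C j) (sym (+-identityʳ n)))
  C-mono* (suc a) = ≤-trans (C-mono* a)
    (≤-trans (C-mono (n + a) j) (≤-reflexive (cong (_C j) (sym (+-suc n a)))))

-- Split `a * r` elements into `r` blocks of size `a` and count only the transversals.
^≤C : ∀ a r → a ^ r ≤ (a * r) C r
^≤C a zero    = ≤-reflexive (sym (nC0≡1 (a * 0)))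
^≤C a (suc r) = begin
  a * a ^ r             ≤⟨ *-monoʳ-≤ a (^≤C a r) ⟩
  a * ((a * r) C r)     ≤⟨ C-step a (a * r) r ⟩
  (a * r + a) C suc r   ≡⟨ cong (_C suc r) (trans (+-comm (a * r) a) (sym (*-suc a r))) ⟩
  (a * suc r) C suc r   ∎
  where open ≤-Reasoning

^-distribʳ-* : ∀ r a b → (a * b) ^ r ≡ a ^ r * b ^ r
^-distribʳ-* zero    a b = refl
^-distribʳ-* (suc r) a b = trans (cong (a * b *_) (^-distribʳ-* r a b)) (lem a b (a ^ r) (b ^ r))
  where
  lem : ∀ a b x y → a * b * (x * y) ≡ a * x * (b * y)
  lem = solve-∀

-- Multiply `^≤C` over the peeled labels. This many equally likely subwords pay for the union bound
-- over tuples.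
!^≤matchings# : ∀ r k → (k !) ^ r ≤ matchings# r k
!^≤matchings# r zero    = ≤-reflexive (^-zeroˡ r)
!^≤matchings# r (suc k) = begin
  (suc k * k !) ^ r                     ≡⟨ ^-distribʳ-* r (suc k) (k !) ⟩
  suc k ^ r * (k !) ^ r                 ≤⟨ *-mono-≤ (^≤C (suc k) r) (!^≤matchings# r k) ⟩
  ((suc k * r) C r) * matchings# r k      ∎
  where open ≤-Reasoning

-- (1 + 1/k)^i ≤ 1/(1 - i/k)
∸-suc : ∀ k i → suc i ≤ k → k ∸ i ≡ suc (k ∸ suc i)
∸-suc (suc k) i (s≤s h) = +-∸-assoc 1 h

[1+k]^i*[k∸i]≤k^[1+i] : ∀ k i → suc k ^ i * (k ∸ i) ≤ k ^ suc i
[1+k]^i*[k∸i]≤k^[1+i] k zero    = ≤-reflexive (trans (*-identityˡ k) (sym (*-identityʳ k)))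
[1+k]^i*[k∸i]≤k^[1+i] k (suc i) = begin
  suc k * suc k ^ i * (k ∸ suc i)      ≡⟨ lem (suc k) (suc k ^ i) (k ∸ suc i) ⟩
  suc k ^ i * (suc k * (k ∸ suc i))    ≤⟨ *-monoʳ-≤ (suc k ^ i) step ⟩
  suc k ^ i * (k * (k ∸ i))            ≡⟨ lem′ (suc k ^ i) k (k ∸ i) ⟩
  k * (suc k ^ i * (k ∸ i))            ≤⟨ *-monoʳ-≤ k ([1+k]^i*[k∸i]≤k^[1+i] k i) ⟩
  k * k ^ suc i                        ∎
  where
  open ≤-Reasoning
  lem : ∀ a b c → a * b * c ≡ b * (a * c)
  lem = solve-∀
  lem′ : ∀ a b c → a * (b * c) ≡ b * (a * c)
  lem′ = solve-∀
  step : suc k * (k ∸ suc i) ≤ k * (k ∸ i)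
  step with suc i ≤? k
  ... | no h  = ≤-trans (≤-reflexive (trans (cong (suc k *_) (m≤n⇒m∸n≡0 (<⇒≤ (≰⇒> h)))) (*-zeroʳ (suc k)))) z≤n
  ... | yes h = ≤-trans (+-monoˡ-≤ (k * (k ∸ suc i)) (m∸n≤m k (suc i)))
       (≤-reflexive (trans (sym (*-suc k (k ∸ suc i))) (cong (k *_) (sym (∸-suc k i h)))))

-- For `i` up to `k / 2` the bound `1/(1 - i/k)` is at most 2.
half-power : ∀ k i → i + i ≤ k → 1 ≤ k → suc k ^ i ≤ 2 * k ^ i
half-power k@(suc _) i h _ = *-cancelˡ-≤ k (begin
  k * suc k ^ i               ≤⟨ *-monoˡ-≤ (suc k ^ i) k≤ ⟩
  2 * (k ∸ i) * suc k ^ i     ≡⟨ lem 2 (k ∸ i) (suc k ^ i) ⟩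
  2 * (suc k ^ i * (k ∸ i))   ≤⟨ *-monoʳ-≤ 2 ([1+k]^i*[k∸i]≤k^[1+i] k i) ⟩
  2 * (k * k ^ i)             ≡⟨ lem′ 2 k (k ^ i) ⟩
  k * (2 * k ^ i)             ∎)
  where
  open ≤-Reasoning
  lem : ∀ a b c → a * b * c ≡ a * (c * b)
  lem = solve-∀
  lem′ : ∀ a b c → a * (b * c) ≡ b * (a * c)
  lem′ = solve-∀
  k≤ : k ≤ 2 * (k ∸ i)
  k≤ = begin
    k                       ≡⟨ m∸n+n≡m (≤-trans (m≤m+n i i) h) ⟨
    (k ∸ i) + i             ≤⟨ +-monoʳ-≤ (k ∸ i) (m+n≤o⇒m≤o∸n i h) ⟩
    (k ∸ i) + (k ∸ i)       ≡⟨ cong ((k ∸ i) +_) (+-identityʳ (k ∸ i)) ⟨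
    2 * (k ∸ i)             ∎

halving : ∀ k → ∃ λ i → ∃ λ b → b ≤ 1 × k ≡ i + i + b
halving zero          = 0 , 0 , z≤n , refl
halving (suc zero)    = 0 , 1 , ≤-refl , refl
halving (suc (suc k)) with halving k
... | i , b , b≤1 , e = suc i , b , b≤1 , cong suc (trans (cong suc e) (cong (_+ b) (sym (+-suc i i))))

-- Two halves of the exponent and a remainder of at most one give three factors of at most 2. The
-- crude constant 8 stands in for Euler's number.
[1+k]^k≤8k^k : ∀ k → suc k ^ k ≤ 8 * k ^ k
[1+k]^k≤8k^k zero         = s≤s z≤n
[1+k]^k≤8k^k k@(suc k-1) with halving k
... | i , b , b≤1 , e = begin
    suc k ^ k                              ≡⟨ cong (suc k ^_) e ⟩
    suc k ^ (i + i + b)                    ≡⟨ ^3 (suc k) ⟩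
    suc k ^ i * suc k ^ i * suc k ^ b      ≤⟨ *-mono-≤ (*-mono-≤ hp hp) (rest≤ b≤1) ⟩
    2 * k ^ i * (2 * k ^ i) * (2 * k ^ b)  ≡⟨ lem (k ^ i) (k ^ b) ⟩
    8 * (k ^ i * k ^ i * k ^ b)            ≡⟨ cong (8 *_) (^3 k) ⟨
    8 * k ^ (i + i + b)                    ≡⟨ cong (λ x → 8 * k ^ x) e ⟨
    8 * k ^ k                              ∎
  where
  open ≤-Reasoning
  lem : ∀ x y → 2 * x * (2 * x) * (2 * y) ≡ 8 * (x * x * y)
  lem = solve-∀
  hp : suc k ^ i ≤ 2 * k ^ i
  hp = half-power k i (≤-trans (m≤m+n (i + i) b) (≤-reflexive (sym e))) (s≤s z≤n)
  ^3 : ∀ x → x ^ (i + i + b) ≡ x ^ i * x ^ i * x ^ b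
  ^3 x = trans (^-distribˡ-+-* x (i + i) b) (cong (_* x ^ b) (^-distribˡ-+-* x i i))
  1+k≤2k : suc k ≤ 2 * k
  1+k≤2k = s≤s (≤-trans (m≤n+m k k-1) (≤-reflexive (cong (k-1 +_) (sym (+-identityʳ k)))))
  rest≤ : ∀ {b} → b ≤ 1 → suc k ^ b ≤ 2 * k ^ b
  rest≤ {zero}  _ = s≤s z≤n
  rest≤ {suc zero} _ = ≤-trans (≤-reflexive (*-identityʳ (suc k)))
                         (≤-trans 1+k≤2k (≤-reflexive (cong (2 *_) (sym (*-identityʳ k)))))
  rest≤ {suc (suc _)} (s≤s ())

-- From `k` to `suc k` the left side grows by a factor of at most `8 * suc k`, and the right side by
-- exactly that.
k^k≤8^k*k! : ∀ k → k ^ k ≤ 8 ^ k * k !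
k^k≤8^k*k! zero    = ≤-refl
k^k≤8^k*k! (suc k) = begin
  suc k * suc k ^ k               ≤⟨ *-monoʳ-≤ (suc k) ([1+k]^k≤8k^k k) ⟩
  suc k * (8 * k ^ k)             ≤⟨ *-monoʳ-≤ (suc k) (*-monoʳ-≤ 8 (k^k≤8^k*k! k)) ⟩
  suc k * (8 * (8 ^ k * k !))     ≡⟨ lem (suc k) 8 (8 ^ k) (k !) ⟩
  8 ^ suc k * (suc k) !           ∎
  where
  open ≤-Reasoning
  lem : ∀ a b c d → a * (b * (c * d)) ≡ b * c * (a * d)
  lem = solve-∀

-- (1 - 1/(1+d))^(1+d) ≤ 1/2
2*d^[1+d]≤[1+d]^[1+d] : ∀ d → 2 * d ^ suc d ≤ suc d ^ suc d
2*d^[1+d]≤[1+d]^[1+d] d = begin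
  2 * d ^ suc d                 ≡⟨ cong (d ^ suc d +_) (+-identityʳ (d ^ suc d)) ⟩
  d ^ suc d + d * d ^ d         ≤⟨ +-monoʳ-≤ (d ^ suc d) (m≤n+m (d * d ^ d) (d ^ d)) ⟩
  d ^ suc d + suc d * d ^ d     ≤⟨ bernoulli d (suc d) ⟩
  suc d ^ suc d                 ∎
  where
  open ≤-Reasoning
  -- The first two terms of the binomial expansion. At `j = 0` the truncated exponent is harmless,
  -- as its coefficient is zero.
  bernoulli : ∀ d j → d ^ j + j * d ^ (j ∸ 1) ≤ suc d ^ j
  bernoulli d zero          = ≤-refl
  bernoulli d (suc zero)    = ≤-reflexive (lem″ d)
    where
    lem″ : ∀ d → d * 1 + 1 ≡ suc d * 1
    lem″ = solve-∀
  bernoulli d (suc j@(suc i)) = begin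
    d * d ^ j + suc j * d ^ j           ≡⟨ lem″ d (d ^ i) (d ^ j) j ⟩
    d ^ j + d * d ^ j + j * (d * d ^ i) ≤⟨ m≤m+n _ (j * d ^ i) ⟩
    d ^ j + d * d ^ j + j * (d * d ^ i) + j * d ^ i ≡⟨ lem‴ d (d ^ i) (d ^ j) j ⟩
    suc d * (d ^ j + j * d ^ i)         ≤⟨ *-monoʳ-≤ (suc d) (bernoulli d j) ⟩
    suc d * suc d ^ j                   ∎
    where
    lem″ : ∀ d x y j → d * y + suc j * y ≡ y + d * y + j * y
    lem″ = solve-∀
    lem‴ : ∀ d x y j → y + d * y + j * (d * x) + j * x ≡ suc d * (y + j * x)
    lem‴ = solve-∀

-- Exposing the labels of a matching one at a time

-- The colouring `u` encodes the intervals: it sends each point to the template point whose interval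
-- contains it. The mask `b` marks the points of the label being peeled off.
picked : ∀ {m K} → Vec Bool m → Vec (Fin K) m → Fin K → ℕ
picked []          []      p = 0
picked (true ∷ b)  (c ∷ u) p = δ c p + picked b u p
picked (false ∷ b) (c ∷ u) p = picked b u p

remaining : ∀ {m K} (b : Vec Bool m) → Vec (Fin K) m → Vec (Fin K) (falses b)
remaining []          []      = []
remaining (true ∷ b)  (c ∷ u) = remaining b u
remaining (false ∷ b) (c ∷ u) = c ∷ remaining b u

∑-picked : ∀ {m K} (b : Vec Bool m) (u : Vec (Fin K) m) → ∑ (allFin K) (picked b u) ≡ trues b
∑-picked {K = K} []          []      = ∑-0 (allFin K) (λ _ → refl)
∑-picked {K = K} (true ∷ b)  (c ∷ u) = trans (∑-+ (allFin K) (δ c) (picked b u)) (cong₂ _+_ (∑-δ c) (∑-picked b u))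
∑-picked         (false ∷ b) (c ∷ u) = ∑-picked b u

multiplicity-remaining : ∀ {m K} (b : Vec Bool m) (u : Vec (Fin K) m) (p : Fin K) →
  multiplicity (remaining b u) p ≤ multiplicity u p
multiplicity-remaining []          []      p = z≤n
multiplicity-remaining (true ∷ b)  (c ∷ u) p = ≤-trans (multiplicity-remaining b u p) (m≤n+m _ (δ c p))
multiplicity-remaining (false ∷ b) (c ∷ u) p = +-monoʳ-≤ (δ c p) (multiplicity-remaining b u p)

-- Choices of marked points in different intervals are independent, so the sum factors. In the
-- induction, marking the first point shifts the function of its own interval by one, which is why
-- `h` is arbitrary.
∑-masks-∏ : ∀ {m K} (u : Vec (Fin K) m) (h : Fin K → ℕ → ℕ) →
  ∑ (masks m) (λ b → ∏ K (λ p → h p (picked b u p))) ≡ ∏ K (λ p → ∑-subsets (h p) (multiplicity u p))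
∑-masks-∏ {K = K} [] h = trans (+-identityʳ _) (∏-cong K (λ _ → refl))
∑-masks-∏ {suc m} {K} (c ∷ u) h = begin
  ∑ (masks (suc m)) (λ b → ∏ K (λ p → h p (picked b (c ∷ u) p)))
    ≡⟨ trans (∑-masks-suc m _) (∑-+ (masks m) _ _) ⟩
  ∑ (masks m) (λ b → ∏ K (λ p → h p (δ c p + picked b u p))) + ∑ (masks m) (λ b → ∏ K (λ p → h p (picked b u p)))
    ≡⟨ cong₂ _+_ (∑-masks-∏ u (λ p x → h p (δ c p + x))) (∑-masks-∏ u h) ⟩
  ∏ K (λ p → ∑-subsets (λ x → h p (δ c p + x)) (multiplicity u p)) + ∏ K (λ p → ∑-subsets (h p) (multiplicity u p))
    ≡⟨ sym (∏-additive K c off at) ⟩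
  ∏ K (λ p → ∑-subsets (h p) (multiplicity (c ∷ u) p)) ∎
  where
  open ≡-Reasoning
  off : ∀ p → p ≢ c →
    ∑-subsets (h p) (δ c p + multiplicity u p) ≡ ∑-subsets (λ x → h p (δ c p + x)) (multiplicity u p) ×
    ∑-subsets (h p) (δ c p + multiplicity u p) ≡ ∑-subsets (h p) (multiplicity u p)
  off p p≢c rewrite δ-≢ {x = c} {p} (p≢c ∘ sym) = refl , refl
  at : ∑-subsets (h c) (δ c c + multiplicity u c) ≡
    ∑-subsets (λ x → h c (δ c c + x)) (multiplicity u c) + ∑-subsets (h c) (multiplicity u c)
  at rewrite δ-refl c = refl

incidence : ∀ {m n K} → Vec (Fin n) m → Vec (Fin K) m → Fin n → Fin K → ℕ
incidence []      []      i p = 0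
incidence (x ∷ M) (c ∷ u) i p = δ x i * δ c p + incidence M u i p

incidence-merge-zero : ∀ {m n K} (b : Vec Bool m) (w : Vec (Fin n) (falses b)) (u : Vec (Fin K) m) p →
  incidence (merge b w) u zero p ≡ picked b u p
incidence-merge-zero []          w       []      p = refl
incidence-merge-zero (true ∷ b)  w       (c ∷ u) p = cong₂ _+_ (+-identityʳ (δ c p)) (incidence-merge-zero b w u p)
incidence-merge-zero (false ∷ b) (x ∷ w) (c ∷ u) p = incidence-merge-zero b w u p

incidence-merge-suc : ∀ {m n K} (b : Vec Bool m) (w : Vec (Fin n) (falses b)) (u : Vec (Fin K) m) i p →
  incidence (merge b w) u (suc i) p ≡ incidence w (remaining b u) i p
incidence-merge-suc []          []      []      i p = refl
incidence-merge-suc (true ∷ b)  w       (c ∷ u) i p = incidence-merge-suc b w u i p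
incidence-merge-suc (false ∷ b) (x ∷ w) (c ∷ u) i p =
  cong₂ _+_ (cong (_* δ c p) (δ-suc x i)) (incidence-merge-suc b w u i p)

-- Either every interval of the edge keeps at least `ℓ` points, and the product is large enough, or
-- one of them lacks at least `ℓ` of its `2 * ℓ` points, and the second summand suffices alone.
-- Written as a sum, the alternative can be added up over the template edges.
∏-C-lower : ∀ K ℓ (x e : Fin K → ℕ) → (∀ p → e p ≤ 1) →
  ℓ * ℓ ^ ∑ (allFin K) e ≤
  ℓ * ∏ K (λ p → x p C e p) + ℓ ^ ∑ (allFin K) e * ∑ (allFin K) (λ p → e p * (2 * ℓ ∸ x p))
∏-C-lower K ℓ x e e≤1 with all? (λ p → ℓ ^ e p ≤? x p C e p)
... | yes h = ≤-trans (*-monoʳ-≤ ℓ (≤-trans (≤-reflexive (sym (∏-^ K ℓ e))) (∏-mono K h))) (m≤m+n _ _)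
... | no ¬h with ¬∀⟶∃¬ K (λ p → ℓ ^ e p ≤ x p C e p) (λ p → ℓ ^ e p ≤? x p C e p) ¬h
...   | p , ¬hp = ≤-trans (≤-reflexive (*-comm ℓ _)) (≤-trans (*-monoʳ-≤ (ℓ ^ ∑ (allFin K) e)
          (≤-trans (short (e p) (x p) (e≤1 p) ¬hp) (term≤∑ (λ p → e p * (2 * ℓ ∸ x p)) p))) (m≤n+m _ _))
  where
  short : ∀ e x → e ≤ 1 → ¬ (ℓ ^ e ≤ x C e) → ℓ ≤ e * (2 * ℓ ∸ x)
  short zero          x _ ¬h = ⊥-elim (¬h (≤-reflexive (sym (nC0≡1 x))))
  short (suc (suc _)) x (s≤s ()) _
  short (suc zero)    x _ ¬h = ≤-trans (m+n≤o⇒m≤o∸n ℓ ℓ+x≤2ℓ) (≤-reflexive (sym (+-identityʳ _)))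
    where
    x<ℓ : x < ℓ
    x<ℓ = ≰⇒> λ ℓ≤x → ¬h (≤-trans (≤-reflexive (*-identityʳ ℓ)) (≤-trans ℓ≤x (≤-reflexive (sym (nC1≡n x)))))
    ℓ+x≤2ℓ : ℓ + x ≤ 2 * ℓ
    ℓ+x≤2ℓ = ≤-trans (+-monoʳ-≤ ℓ (<⇒≤ x<ℓ)) (≤-reflexive (cong (ℓ +_) (sym (+-identityʳ ℓ))))

∑-deficit : ∀ {m K} ℓ (u : Vec (Fin K) m) → (∀ p → multiplicity u p ≤ ℓ) →
  ∑ (allFin K) (λ p → ℓ ∸ multiplicity u p) + m ≡ K * ℓ
∑-deficit {m} {K} ℓ u h = begin
  ∑ (allFin K) (λ p → ℓ ∸ multiplicity u p) + m
    ≡⟨ cong (∑ (allFin K) (λ p → ℓ ∸ multiplicity u p) +_) (sym (∑-multiplicity u)) ⟩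
  ∑ (allFin K) (λ p → ℓ ∸ multiplicity u p) + ∑ (allFin K) (multiplicity u)
    ≡⟨ sym (∑-+ (allFin K) _ _) ⟩
  ∑ (allFin K) (λ p → ℓ ∸ multiplicity u p + multiplicity u p)
    ≡⟨ ∑-cong (allFin K) (λ p → m∸n+n≡m (h p)) ⟩
  ∑ (allFin K) (λ _ → ℓ)
    ≡⟨ trans (∑-const (allFin K) ℓ) (cong (_* ℓ) (ListP.length-tabulate {n = K} id)) ⟩
  K * ℓ ∎
  where open ≡-Reasoning

-- Template edges and the labels that hit them.

module Template {r k K : ℕ} (T : Vec (Fin k) K) (T-matching : Matching r T) (r≥1 : 1 ≤ r) where

  edge : Fin k → Fin K → ℕ
  edge τ p = δ (lookup T p) τ

  ∑-edge : ∀ τ → ∑ (allFin K) (edge τ) ≡ r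
  ∑-edge τ = trans (sym (mult T)) (T-matching τ)
    where
    mult : ∀ {K} (T : Vec (Fin k) K) → multiplicity T τ ≡ ∑ (allFin K) (λ p → δ (lookup T p) τ)
    mult []      = refl
    mult (x ∷ T) = trans (cong (δ x τ +_) (mult T)) (sym (∑-allFin-suc (λ p → δ (lookup (x ∷ T) p) τ)))

  edge-injective : ∀ τ τ′ → (∀ p → edge τ p ≡ edge τ′ p) → τ ≡ τ′
  edge-injective τ τ′ h with occurs T τ (λ e → <⇒≢ r≥1 (trans (sym e) (T-matching τ)))
  ... | p , refl = δ≢0⇒≡ (λ e → 1+n≢0 (trans (sym (δ-refl τ)) (trans (h p) e)))

  -- Equality is asked in all `K` intervals, not only in those of `τ`: the number of hitting masks
  -- is then a product of binomial coefficients, and a mask determines the edge it hits.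
  hit : ∀ {m} → Vec Bool m → Vec (Fin K) m → Fin k → ℕ
  hit b u τ = ∏ K (λ p → ind (picked b u p ℕP.≟ edge τ p))

  hit≢0 : ∀ {m} (b : Vec Bool m) (u : Vec (Fin K) m) τ → hit b u τ ≢ 0 → ∀ p → picked b u p ≡ edge τ p
  hit≢0 b u τ h p = ind≢0 (picked b u p ℕP.≟ edge τ p) (∏≢0⇒ K _ h p)

  hit≤1 : ∀ {m} (b : Vec Bool m) (u : Vec (Fin K) m) τ → hit b u τ ≤ 1
  hit≤1 b u τ = ∏≤1 K _ (λ p → ind≤1 (picked b u p ℕP.≟ edge τ p))

  ∑-hit : ∀ {m} (u : Vec (Fin K) m) τ → ∑ (masks m) (λ b → hit b u τ) ≡ ∏ K (λ p → multiplicity u p C edge τ p)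
  ∑-hit u τ = trans (∑-masks-∏ u (λ p x → ind (x ℕP.≟ edge τ p))) (∏-cong K (λ p → ∑-subsets-C _ (edge τ p)))

  hits : ∀ {m} → (Fin k → ℕ) → Vec (Fin K) m → Vec Bool m → ℕ
  hits a u b = ∑ (allFin k) (λ τ → a τ * hit b u τ)

  hits≤1 : ∀ {m} (a : Fin k → ℕ) (u : Vec (Fin K) m) b → (∀ τ → a τ ≤ 1) → hits a u b ≤ 1
  hits≤1 a u b a≤1 = ∑-unique≤1 _ (λ τ → *-mono-≤ (a≤1 τ) (hit≤1 b u τ)) λ τ τ′ h h′ →
    edge-injective τ τ′ (λ p → trans (sym (hit≢0 b u τ (nonzero τ h) p)) (hit≢0 b u τ′ (nonzero τ′ h′) p))
    where
    nonzero : ∀ τ → a τ * hit b u τ ≢ 0 → hit b u τ ≢ 0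
    nonzero τ h e = h (trans (cong (a τ *_) e) (*-zeroʳ (a τ)))

  hits-witness : ∀ {m} (a : Fin k → ℕ) (u : Vec (Fin K) m) b → hits a u b ≢ 0 →
    ∃ λ τ → a τ ≢ 0 × ∀ p → picked b u p ≡ edge τ p
  hits-witness a u b h with ∑-zero-or-witness (allFin k) (λ τ → a τ * hit b u τ)
  ... | inj₁ e = ⊥-elim (h e)
  ... | inj₂ (τ , ne) = τ , (λ e → ne (cong (_* hit b u τ) e)) ,
          hit≢0 b u τ (λ e → ne (trans (cong (a τ *_) e) (*-zeroʳ (a τ))))

  -- Every template point lies on exactly one edge. Summed over the edges, the losses therefore give
  -- the total deficit of the intervals, however it is distributed.
  ∑-hits-lower : ∀ {m} ℓ (a : Fin k → ℕ) (u : Vec (Fin K) m) → (∀ τ → a τ ≤ 1) →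
    ∑ (allFin k) a * (ℓ * ℓ ^ r) ≤
    ℓ * ∑ (masks m) (hits a u) + ℓ ^ r * ∑ (allFin K) (λ p → 2 * ℓ ∸ multiplicity u p)
  ∑-hits-lower {m} ℓ a u a≤1 = begin
    ∑ (allFin k) a * (ℓ * ℓ ^ r)
      ≡⟨ ∑-*ʳ (allFin k) (ℓ * ℓ ^ r) a ⟨
    ∑ (allFin k) (λ τ → a τ * (ℓ * ℓ ^ r))
      ≤⟨ ∑-mono (allFin k) per-edge ⟩
    ∑ (allFin k) (λ τ → ℓ * (a τ * masks# τ) + ℓ ^ r * loss τ)
      ≡⟨ trans (∑-+ (allFin k) _ _) (cong₂ _+_ (∑-*ˡ (allFin k) ℓ _) (∑-*ˡ (allFin k) (ℓ ^ r) _)) ⟩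
    ℓ * ∑ (allFin k) (λ τ → a τ * masks# τ) + ℓ ^ r * ∑ (allFin k) loss
      ≡⟨ cong₂ (λ x y → ℓ * x + ℓ ^ r * y) masks-total loss-total ⟩
    ℓ * ∑ (masks m) (hits a u) + ℓ ^ r * ∑ (allFin K) (λ p → 2 * ℓ ∸ multiplicity u p) ∎
    where
    open ≤-Reasoning
    masks# loss : Fin k → ℕ
    masks# τ = ∏ K (λ p → multiplicity u p C edge τ p)
    loss τ = ∑ (allFin K) (λ p → edge τ p * (2 * ℓ ∸ multiplicity u p))
    lem : ∀ a x y z w → a * (x * y + z * w) ≡ x * (a * y) + z * (a * w)
    lem = solve-∀
    per-edge : ∀ τ → a τ * (ℓ * ℓ ^ r) ≤ ℓ * (a τ * masks# τ) + ℓ ^ r * loss τ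
    per-edge τ = begin
      a τ * (ℓ * ℓ ^ r)
        ≤⟨ *-monoʳ-≤ (a τ) (subst (λ s → ℓ * ℓ ^ s ≤ ℓ * masks# τ + ℓ ^ s * loss τ) (∑-edge τ)
             (∏-C-lower K ℓ (multiplicity u) (edge τ) (λ p → ind≤1 (lookup T p ≟ τ)))) ⟩
      a τ * (ℓ * masks# τ + ℓ ^ r * loss τ)
        ≡⟨ lem (a τ) ℓ (masks# τ) (ℓ ^ r) (loss τ) ⟩
      ℓ * (a τ * masks# τ) + ℓ ^ r * (a τ * loss τ)
        ≤⟨ +-monoʳ-≤ (ℓ * (a τ * masks# τ)) (*-monoʳ-≤ (ℓ ^ r)
             (≤-trans (*-monoˡ-≤ (loss τ) (a≤1 τ)) (≤-reflexive (*-identityˡ _)))) ⟩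
      ℓ * (a τ * masks# τ) + ℓ ^ r * loss τ ∎
    masks-total : ∑ (allFin k) (λ τ → a τ * masks# τ) ≡ ∑ (masks m) (hits a u)
    masks-total = trans (∑-cong (allFin k) (λ τ → trans (cong (a τ *_) (sym (∑-hit u τ)))
      (sym (∑-*ˡ (masks m) (a τ) _)))) (∑-swap (allFin k) (masks m) _)
    loss-total : ∑ (allFin k) loss ≡ ∑ (allFin K) (λ p → 2 * ℓ ∸ multiplicity u p)
    loss-total = trans (∑-swap (allFin k) (allFin K) _) (∑-cong (allFin K) (λ p →
      trans (∑-*ʳ (allFin k) (2 * ℓ ∸ multiplicity u p) (λ τ → edge τ p))
        (trans (cong (_* (2 * ℓ ∸ multiplicity u p)) (∑-δ (lookup T p))) (*-identityˡ _))))

  -- `edgeOf` takes a membership proof, so that labels outside the set get no dummy edge. The field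
  -- `available` is what keeps later hits away from an edge already removed from `a`.
  record Hits {n m} (u : Vec (Fin K) m) (a : Fin k → ℕ) (g : ℕ) (M : Vec (Fin n) m) : Set where
    field
      labels        : Subset n
      size          : g ≤ ∣ labels ∣
      edgeOf        : ∀ {i} → i ∈ labels → Fin k
      available     : ∀ {i} (i∈ : i ∈ labels) → a (edgeOf i∈) ≢ 0
      incident      : ∀ {i} (i∈ : i ∈ labels) p → incidence M u i p ≡ edge (edgeOf i∈) p
      edgeOf-injective : ∀ {i j} (i∈ : i ∈ labels) (j∈ : j ∈ labels) → edgeOf i∈ ≡ edgeOf j∈ → i ≡ j

  no-hits : ∀ {n m} (u : Vec (Fin K) m) a (M : Vec (Fin n) m) → Hits u a 0 M
  no-hits u a M = record
    { labels           = ⊥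
    ; size             = z≤n
    ; edgeOf           = λ i∈ → ⊥-elim (∉⊥ i∈)
    ; available        = λ i∈ → ⊥-elim (∉⊥ i∈)
    ; incident         = λ i∈ → ⊥-elim (∉⊥ i∈)
    ; edgeOf-injective = λ i∈ → ⊥-elim (∉⊥ i∈)
    }

  skip : ∀ {n m a g} {u : Vec (Fin K) m} (b : Vec Bool m) (w : Vec (Fin n) (falses b)) →
    Hits (remaining b u) a g w → Hits u a g (merge b w)
  skip {u = u} b w H = record
    { labels           = outside ∷ labels
    ; size             = size
    ; edgeOf           = λ { (there i∈) → edgeOf i∈ }
    ; available        = λ { (there i∈) → available i∈ }
    ; incident         = λ { (there i∈) p → trans (incidence-merge-suc b w u _ p) (incident i∈ p) }
    ; edgeOf-injective = λ { (there i∈) (there j∈) e → cong suc (edgeOf-injective i∈ j∈ e) }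
    }
    where open Hits H

  _without_ : (Fin k → ℕ) → Fin k → Fin k → ℕ
  (a without τ) σ = a σ ∸ δ τ σ

  ∑-without : ∀ a τ → a τ ≢ 0 → suc (∑ (allFin k) (a without τ)) ≡ ∑ (allFin k) a
  ∑-without a τ aτ≢0 = begin
    suc (∑ (allFin k) (a without τ))                            ≡⟨ +-comm 1 _ ⟩
    ∑ (allFin k) (a without τ) + 1                              ≡⟨ cong (∑ (allFin k) (a without τ) +_) (sym (∑-δ τ)) ⟩
    ∑ (allFin k) (a without τ) + ∑ (allFin k) (δ τ)             ≡⟨ sym (∑-+ (allFin k) (a without τ) (δ τ)) ⟩
    ∑ (allFin k) (λ σ → a σ ∸ δ τ σ + δ τ σ)                    ≡⟨ ∑-cong (allFin k) (λ σ → m∸n+n≡m (δ≤a σ)) ⟩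
    ∑ (allFin k) a                                              ∎
    where
    open ≡-Reasoning
    δ≤a : ∀ σ → δ τ σ ≤ a σ
    δ≤a σ with τ ≟ σ
    ... | yes refl = n≢0⇒n>0 aτ≢0
    ... | no _     = z≤n

  -- Removing `τ` from the available edges before the other labels are exposed forces their hits
  -- onto different edges, so `edgeOf` stays injective.
  extend : ∀ {n m a g} {u : Vec (Fin K) m} (b : Vec Bool m) (w : Vec (Fin n) (falses b)) τ →
    (∀ σ → a σ ≤ 1) → a τ ≢ 0 → (∀ p → picked b u p ≡ edge τ p) →
    Hits (remaining b u) (a without τ) g w → Hits u a (suc g) (merge b w)
  extend {a = a} {u = u} b w τ a≤1 aτ≢0 h H = record
    { labels           = inside ∷ labels
    ; size             = s≤s size
    ; edgeOf           = λ { here → τ ; (there i∈) → edgeOf i∈ }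
    ; available        = λ { here → aτ≢0 ; (there i∈) e → available i∈ (trans (cong (_∸ δ τ (edgeOf i∈)) e) (0∸n≡0 (δ τ (edgeOf i∈)))) }
    ; incident         = λ { here p → trans (incidence-merge-zero b w u p) (h p)
                           ; (there i∈) p → trans (incidence-merge-suc b w u _ p) (incident i∈ p) }
    ; edgeOf-injective = λ { here here _ → refl
                           ; here (there j∈) e → ⊥-elim (fresh j∈ (sym e))
                           ; (there i∈) here e → ⊥-elim (fresh i∈ e)
                           ; (there i∈) (there j∈) e → cong suc (edgeOf-injective i∈ j∈ e) }
    }
    where
    open Hits H
    fresh : ∀ {i} (i∈ : i ∈ labels) → edgeOf i∈ ≢ τ
    fresh i∈ e = available i∈ (trans (cong (a without τ) e)
      (trans (cong (a τ ∸_) (δ-refl τ)) (m≤n⇒m∸n≡0 (a≤1 τ))))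

  -- Labels are exposed one at a time.  While at least 2κ template edges are available and few
  -- points are used, the next label hits one of them with probability at least 2/(1+d), so
  -- the expectation of 2^(g - #hits) drops by a factor d/(1+d) per exposed label.
  module Exposure (ℓ κ d : ℕ) (ℓ≥1 : 1 ≤ ℓ) (κ≥1 : 1 ≤ κ) (κ≤K : κ ≤ K)
    (dense : 2 * (2 * ℓ * K) ^ r ≤ suc d * (κ * ℓ ^ r)) where

    -- At most `κ * ℓ` points are missing, which spoils at most `κ` of the `2 * κ` available edges.
    -- Each of the others is hit by at least `ℓ ^ r` masks, out of at most `(2 * ℓ * K) ^ r` masks
    -- in all.
    hits-dense : ∀ {m} (u : Vec (Fin K) m) a → (∀ p → multiplicity u p ≤ 2 * ℓ) → (∀ τ → a τ ≤ 1) →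
      2 * κ ≤ ∑ (allFin k) a → 2 * ℓ * K ≤ m + κ * ℓ → 2 * (m C r) ≤ suc d * ∑ (masks m) (hits a u)
    hits-dense {m} u a u≤ a≤1 a≥ room = begin
      2 * (m C r)                      ≤⟨ *-monoʳ-≤ 2 (≤-trans (C≤^ m r) (^-monoˡ-≤ r m≤)) ⟩
      2 * (2 * ℓ * K) ^ r              ≤⟨ dense ⟩
      suc d * (κ * ℓ ^ r)              ≤⟨ *-monoʳ-≤ (suc d) (*-cancelˡ-≤ ℓ {{>-nonZero ℓ≥1}} enough) ⟩
      suc d * ∑ (masks m) (hits a u)   ∎
      where
      open ≤-Reasoning
      Δ s : ℕ
      Δ = ∑ (allFin K) (λ p → 2 * ℓ ∸ multiplicity u p)
      s = ∑ (masks m) (hits a u)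
      Δ+m : Δ + m ≡ 2 * ℓ * K
      Δ+m = trans (∑-deficit (2 * ℓ) u u≤) (*-comm K (2 * ℓ))
      m≤ : m ≤ 2 * ℓ * K
      m≤ = ≤-trans (m≤n+m m Δ) (≤-reflexive Δ+m)
      Δ≤ : Δ ≤ κ * ℓ
      Δ≤ = +-cancelˡ-≤ m Δ (κ * ℓ) (≤-trans (≤-reflexive (trans (+-comm m Δ) Δ+m)) room)
      lem : ∀ κ ℓ x → ℓ * (κ * x) + x * (κ * ℓ) ≡ 2 * κ * (ℓ * x)
      lem = solve-∀
      enough : ℓ * (κ * ℓ ^ r) ≤ ℓ * s
      enough = +-cancelʳ-≤ (ℓ ^ r * (κ * ℓ)) _ _ (begin
        ℓ * (κ * ℓ ^ r) + ℓ ^ r * (κ * ℓ)     ≡⟨ lem κ ℓ (ℓ ^ r) ⟩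
        2 * κ * (ℓ * ℓ ^ r)                   ≤⟨ *-monoˡ-≤ (ℓ * ℓ ^ r) a≥ ⟩
        ∑ (allFin k) a * (ℓ * ℓ ^ r)          ≤⟨ ∑-hits-lower ℓ a u a≤1 ⟩
        ℓ * s + ℓ ^ r * Δ                     ≤⟨ +-monoʳ-≤ (ℓ * s) (*-monoʳ-≤ (ℓ ^ r) Δ≤) ⟩
        ℓ * s + ℓ ^ r * (κ * ℓ)               ∎)

    -- Here `t` labels are still to be exposed and `g` hits are still missing. A hit lowers `g` and
    -- the number of available edges together, so `2 * κ` edges always remain; each exposure takes
    -- `r` points out of the slack in `room`. The weight `f` is arbitrary on bad words because
    -- fixing a mask yields only some of the words that are bad for the remaining problem.
    few-hits-rare : ∀ t n {m} (u : Vec (Fin K) m) a g (f : Vec (Fin n) m → ℕ) →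
      m ≡ n * r → (∀ p → multiplicity u p ≤ 2 * ℓ) → (∀ τ → a τ ≤ 1) →
      g + 2 * κ ≤ ∑ (allFin k) a → 2 * ℓ * K + t * r ≤ m + κ * ℓ →
      (∀ M → f M ≤ 1) → (∀ M → f M ≢ 0 → Matching r M × ¬ Hits u a g M) →
      ∑ (allVecs m n) f * suc d ^ t ≤ matchings# r n * (2 ^ g * d ^ t)
    few-hits-rare t n {m} u a zero f e u≤ a≤1 a≥ room f≤1 bad =
      ≤-trans (≤-reflexive (cong (_* suc d ^ t) (∑-0 (allVecs m n) zero-f))) z≤n
      where
      zero-f : ∀ M → f M ≡ 0
      zero-f M with f M ℕP.≟ 0
      ... | yes h = h
      ... | no ¬h = ⊥-elim (proj₂ (bad M ¬h) (no-hits u a M))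
    few-hits-rare zero n {m} u a g@(suc _) f e u≤ a≤1 a≥ room f≤1 bad = begin
      ∑ (allVecs m n) f * 1                            ≡⟨ *-identityʳ _ ⟩
      ∑ (allVecs m n) f                                ≤⟨ ∑-mono (allVecs m n) f≤ ⟩
      ∑ (allVecs m n) (λ v → ind (matching? r v))      ≡⟨ ∑-matching n e ⟩
      matchings# r n                                   ≤⟨ m≤m*n (matchings# r n) (2 ^ g * 1) {{nz}} ⟩
      matchings# r n * (2 ^ g * 1)                     ∎
      where
      open ≤-Reasoning
      nz : NonZero (2 ^ g * 1)
      nz = m*n≢0 (2 ^ g) 1 {{m^n≢0 2 g}}
      f≤ : ∀ M → f M ≤ ind (matching? r M)
      f≤ M with f M ℕP.≟ 0
      ... | yes h = ≤-trans (≤-reflexive h) z≤n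
      ... | no ¬h = ≤-trans (f≤1 M) (≤-reflexive (sym (ind-yes (matching? r M) (proj₁ (bad M ¬h)))))
    -- Without labels there are no points, and `room` fails while an exposure is still due.
    few-hits-rare (suc t) zero {m} u a (suc g) f e u≤ a≤1 a≥ room f≤1 bad = ⊥-elim (<-irrefl refl (begin-strict
      κ * ℓ                     ≤⟨ *-monoˡ-≤ ℓ κ≤K ⟩
      K * ℓ                     ≡⟨ *-comm K ℓ ⟩
      ℓ * K                     ≤⟨ *-monoˡ-≤ K (m≤m+n ℓ _) ⟩
      2 * ℓ * K                 <⟨ m<m+n (2 * ℓ * K) (≤-trans r≥1 (m≤m+n r (t * r))) ⟩
      2 * ℓ * K + suc t * r     ≤⟨ room ⟩
      m + κ * ℓ                 ≡⟨ cong (_+ κ * ℓ) e ⟩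
      κ * ℓ                     ∎))
      where open ≤-Reasoning
    few-hits-rare (suc t) (suc n) {m} u a (suc g) f e u≤ a≤1 a≥ room f≤1 bad = finish
      where
      open ≤-Reasoning
      Z F s c : ℕ
      Z = matchings# r n * (2 ^ g * d ^ t)
      F = ∑ (allVecs m (suc n)) f
      s = ∑ (masks m) (hits a u)
      c = m C r
      inner : Vec Bool m → ℕ
      inner b = ∑ (allVecs (falses b) n) (λ w → f (merge b w))

      inner≡0 : ∀ b → trues b ≢ r → inner b ≡ 0
      inner≡0 b t≢r = ∑-0 (allVecs (falses b) n) λ w → f≡0 w (f (merge b w) ℕP.≟ 0)
        where
        f≡0 : ∀ w → Dec (f (merge b w) ≡ 0) → f (merge b w) ≡ 0
        f≡0 w (yes h) = h
        f≡0 w (no ¬h) = ⊥-elim (t≢r (proj₁ (merge-matching⁻ b w (proj₁ (bad (merge b w) ¬h)))))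

      hits≡0 : ∀ b → trues b ≢ r → hits a u b ≡ 0
      hits≡0 b t≢r with hits a u b ℕP.≟ 0
      ... | yes h = h
      ... | no ¬h with hits-witness a u b ¬h
      ...   | τ , _ , p≡ = ⊥-elim (t≢r (trans (sym (∑-picked b u)) (trans (∑-cong (allFin K) p≡) (∑-edge τ))))

      room′ : ∀ b → trues b ≡ r → 2 * ℓ * K + t * r ≤ falses b + κ * ℓ
      room′ b t≡r = +-cancelˡ-≤ r _ _ (begin
        r + (2 * ℓ * K + t * r)       ≡⟨ x∙yz≈y∙xz r (2 * ℓ * K) (t * r) ⟩
        2 * ℓ * K + suc t * r         ≤⟨ room ⟩
        m + κ * ℓ                     ≡⟨ cong (_+ κ * ℓ) (trans (sym (trues+falses b)) (cong (_+ falses b) t≡r)) ⟩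
        r + falses b + κ * ℓ          ≡⟨ +-assoc r (falses b) (κ * ℓ) ⟩
        r + (falses b + κ * ℓ)        ∎)
        where
        x∙yz≈y∙xz : ∀ x y z → x + (y + z) ≡ y + (x + z)
        x∙yz≈y∙xz = solve-∀

      u≤′ : ∀ b p → multiplicity (remaining b u) p ≤ 2 * ℓ
      u≤′ b p = ≤-trans (multiplicity-remaining b u p) (u≤ p)

      miss : ∀ b → trues b ≡ r → inner b * suc d ^ t ≤ 2 * Z
      miss b t≡r = ≤-trans
        (few-hits-rare t n (remaining b u) a (suc g) (λ w → f (merge b w)) (peel-size n b e t≡r) (u≤′ b) a≤1 a≥
          (room′ b t≡r) (λ w → f≤1 (merge b w))
          (λ w h → proj₂ (merge-matching⁻ b w (proj₁ (bad _ h))) , λ H → proj₂ (bad _ h) (skip b w H)))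
        (≤-reflexive (lem (matchings# r n) (2 ^ g) (d ^ t)))
        where
        lem : ∀ x y z → x * (2 * y * z) ≡ 2 * (x * (y * z))
        lem = solve-∀

      success : ∀ b → trues b ≡ r → hits a u b ≢ 0 → inner b * suc d ^ t ≤ Z
      success b t≡r h≢0 with hits-witness a u b h≢0
      ... | τ , aτ≢0 , p≡ =
        few-hits-rare t n (remaining b u) (a without τ) g (λ w → f (merge b w)) (peel-size n b e t≡r) (u≤′ b)
          (λ σ → ≤-trans (m∸n≤m (a σ) (δ τ σ)) (a≤1 σ))
          (s≤s⁻¹ (≤-trans a≥ (≤-reflexive (sym (∑-without a τ aτ≢0)))))
          (room′ b t≡r) (λ w → f≤1 (merge b w))
          (λ w h → proj₂ (merge-matching⁻ b w (proj₁ (bad _ h))) ,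
                   λ H → proj₂ (bad _ h) (extend b w τ a≤1 aτ≢0 p≡ H))

      -- A mask that hits is charged `Z`. Any other mask of size `r` is charged twice as much, since
      -- one more hit is still missing. So every hit saves one `Z`.
      per-mask : ∀ b → inner b * suc d ^ t + Z * hits a u b ≤ 2 * Z * ind (trues b ℕP.≟ r)
      per-mask b with trues b ℕP.≟ r
      ... | no t≢r = ≤-reflexive (trans (cong₂ _+_ (cong (_* suc d ^ t) (inner≡0 b t≢r))
                       (trans (cong (Z *_) (hits≡0 b t≢r)) (*-zeroʳ Z))) (sym (*-zeroʳ (2 * Z))))
      ... | yes t≡r with hits a u b ℕP.≟ 0
      ...   | yes h≡0 = begin
        inner b * suc d ^ t + Z * hits a u b   ≡⟨ cong (inner b * suc d ^ t +_) (trans (cong (Z *_) h≡0) (*-zeroʳ Z)) ⟩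
        inner b * suc d ^ t + 0                ≡⟨ +-identityʳ _ ⟩
        inner b * suc d ^ t                    ≤⟨ miss b t≡r ⟩
        2 * Z                                  ≡⟨ *-identityʳ (2 * Z) ⟨
        2 * Z * 1                              ∎
      ...   | no h≢0 = begin
        inner b * suc d ^ t + Z * hits a u b   ≤⟨ +-mono-≤ (success b t≡r h≢0) (*-monoʳ-≤ Z (hits≤1 a u b a≤1)) ⟩
        Z + Z * 1                              ≡⟨ lem Z ⟩
        2 * Z * 1                              ∎
        where
        lem : ∀ Z → Z + Z * 1 ≡ 2 * Z * 1
        lem = solve-∀

      total : F * suc d ^ t + Z * s ≤ 2 * Z * c
      total = begin
        F * suc d ^ t + Z * s
          ≡⟨ cong₂ _+_ (trans (cong (_* suc d ^ t) (∑-merge m n f)) (sym (∑-*ʳ (masks m) (suc d ^ t) inner)))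
                       (sym (∑-*ˡ (masks m) Z (hits a u))) ⟩
        ∑ (masks m) (λ b → inner b * suc d ^ t) + ∑ (masks m) (λ b → Z * hits a u b)
          ≡⟨ ∑-+ (masks m) _ _ ⟨
        ∑ (masks m) (λ b → inner b * suc d ^ t + Z * hits a u b)
          ≤⟨ ∑-mono (masks m) per-mask ⟩
        ∑ (masks m) (λ b → 2 * Z * ind (trues b ℕP.≟ r))
          ≡⟨ trans (∑-*ˡ (masks m) (2 * Z) _) (cong (2 * Z *_) (∑-masks-C m r)) ⟩
        2 * Z * c ∎

      density : 2 * c ≤ suc d * s
      density = hits-dense u a u≤ a≤1 (≤-trans (m≤n+m (2 * κ) (suc g)) a≥) (≤-trans (m≤m+n (2 * ℓ * K) (suc t * r)) room)

      -- By `density` the saving `Z * s` is at least the fraction `1 / suc d` of the full charge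
      -- `2 * Z * c`, which leaves the factor `d / suc d`.
      finish : F * suc d ^ suc t ≤ matchings# r (suc n) * (2 ^ suc g * d ^ suc t)
      finish = +-cancelʳ-≤ (Z * (2 * c)) _ _ (begin
        F * suc d ^ suc t + Z * (2 * c)        ≤⟨ +-monoʳ-≤ _ (*-monoʳ-≤ Z density) ⟩
        F * suc d ^ suc t + Z * (suc d * s)    ≡⟨ lem₁ F (suc d) (suc d ^ t) Z s ⟩
        suc d * (F * suc d ^ t + Z * s)        ≤⟨ *-monoʳ-≤ (suc d) total ⟩
        suc d * (2 * Z * c)                    ≡⟨ lem₂ d c (matchings# r n) (2 ^ g) (d ^ t) ⟩
        c * matchings# r n * (2 ^ suc g * d ^ suc t) + Z * (2 * c)
          ≡⟨ cong (λ x → (x C r) * matchings# r n * (2 ^ suc g * d ^ suc t) + Z * (2 * c)) e ⟩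
        matchings# r (suc n) * (2 ^ suc g * d ^ suc t) + Z * (2 * c) ∎)
        where
        lem₁ : ∀ F D x Z s → F * (D * x) + Z * (D * s) ≡ D * (F * x + Z * s)
        lem₁ = solve-∀
        lem₂ : ∀ d c T y x → suc d * (2 * (T * (y * x)) * c) ≡ c * T * (2 * y * (d * x)) + T * (y * x) * (2 * c)
        lem₂ = solve-∀

-- Labels hitting distinct template edges form a clique

-- Built from the right: `stay` puts one more point into the leftmost interval, and `next` opens an
-- empty interval to its left. This matches the recursion of `word`, which runs through the
-- intervals in order.
data Monotone : ∀ {m K} → Vec (Fin K) m → Set where
  done : Monotone {0} {0} []
  stay : ∀ {m K} {u : Vec (Fin (suc K)) m} → Monotone u → Monotone (zero ∷ u)
  next : ∀ {m K} {u : Vec (Fin K) m} → Monotone u → Monotone (Vec.map suc u)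

multiplicity-map-suc : ∀ {m K} (u : Vec (Fin K) m) p → multiplicity (Vec.map suc u) (suc p) ≡ multiplicity u p
multiplicity-map-suc []      p = refl
multiplicity-map-suc (c ∷ u) p = cong₂ _+_ (δ-suc c p) (multiplicity-map-suc u p)

multiplicity-map-zero : ∀ {m K} (u : Vec (Fin K) m) → multiplicity (Vec.map suc u) zero ≡ 0
multiplicity-map-zero []      = refl
multiplicity-map-zero (c ∷ u) = multiplicity-map-zero u

incidence-map-suc : ∀ {m n K} (M : Vec (Fin n) m) (u : Vec (Fin K) m) i p →
  incidence M (Vec.map suc u) i (suc p) ≡ incidence M u i p
incidence-map-suc []      []      i p = refl
incidence-map-suc (x ∷ M) (c ∷ u) i p = cong₂ _+_ (cong (δ x i *_) (δ-suc c p)) (incidence-map-suc M u i p)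

incidence-map-zero : ∀ {m n K} (M : Vec (Fin n) m) (u : Vec (Fin K) m) i →
  incidence M (Vec.map suc u) i zero ≡ 0
incidence-map-zero []      []      i = refl
incidence-map-zero (x ∷ M) (c ∷ u) i = cong₂ _+_ (*-zeroʳ (δ x i)) (incidence-map-zero M u i)

-- Greedy filling from the left; in `fill` the number `c` is the room left in the current interval.
colouring : ∀ K ℓ m → m ≤ K * ℓ → ∃ λ (u : Vec (Fin K) m) → Monotone u × ∀ p → multiplicity u p ≤ ℓ
colouring zero    ℓ zero h = [] , done , λ ()
colouring (suc K) ℓ m    h = fill K ℓ m ≤-refl h
  where
  empty : ∀ K → Monotone {0} {K} []
  empty zero    = done
  empty (suc K) = next (empty K)

  fill : ∀ K c m → c ≤ ℓ → m ≤ c + K * ℓ →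
    ∃ λ (u : Vec (Fin (suc K)) m) → Monotone u × ∀ p → multiplicity u p ≤ ℓ
  fill′ : ∀ K c m → c ≤ ℓ → m ≤ c + K * ℓ →
    ∃ λ (u : Vec (Fin (suc K)) m) → Monotone u × multiplicity u zero ≤ c × ∀ p → multiplicity u (suc p) ≤ ℓ
  fill K c m c≤ℓ h with fill′ K c m c≤ℓ h
  ... | u , mono , u≤c , u≤ℓ = u , mono , λ { zero → ≤-trans u≤c c≤ℓ ; (suc p) → u≤ℓ p }
  fill′ K       c       zero    c≤ℓ h       = [] , empty (suc K) , z≤n , λ _ → z≤n
  fill′ (suc K) zero    (suc m) c≤ℓ h with fill K ℓ (suc m) ≤-refl h
  ... | u , mono , u≤ = Vec.map suc u , next mono , ≤-reflexive (multiplicity-map-zero u) ,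
          λ p → ≤-trans (≤-reflexive (multiplicity-map-suc u p)) (u≤ p)
  fill′ K       (suc c) (suc m) c≤ℓ (s≤s h) with fill′ K c m (≤-trans (n≤1+n c) c≤ℓ) h
  ... | u , mono , u≤c , u≤ℓ = zero ∷ u , stay mono , s≤s u≤c , u≤ℓ

letters : ℕ → ℕ → List Bool
letters x y = replicate x true ++ replicate y false

word : ∀ K → (Fin K → ℕ) → (Fin K → ℕ) → List Bool
word zero    x y = []
word (suc K) x y = letters (x zero) (y zero) ++ word K (x ∘ suc) (y ∘ suc)

word-cong : ∀ K {x x′ y y′ : Fin K → ℕ} → (∀ p → x p ≡ x′ p) → (∀ p → y p ≡ y′ p) → word K x y ≡ word K x′ y′
word-cong zero    h h′ = refl
word-cong (suc K) h h′ = cong₂ _++_ (cong₂ letters (h zero) (h′ zero)) (word-cong K (h ∘ suc) (h′ ∘ suc))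

-- A monotone colouring cuts the word into consecutive intervals. The two labels together have at
-- most one point in each, so the counts alone determine the letters.
pairWord-incidence : ∀ {m n K} (M : Vec (Fin n) m) {u : Vec (Fin K) m} {i j} → i ≢ j → Monotone u →
  (∀ p → incidence M u i p + incidence M u j p ≤ 1) →
  pairWord M i j ≡ word K (incidence M u i) (incidence M u j)
pairWord-incidence [] i≢j done h = refl
pairWord-incidence {K = suc K} M {i = i} {j} i≢j (next {u = u} mono) h = begin
  pairWord M i j                                     ≡⟨ pairWord-incidence M i≢j mono (λ p → subst₂ (λ x y → x + y ≤ 1)
                                                          (incidence-map-suc M u i p) (incidence-map-suc M u j p) (h (suc p))) ⟩
  word K (incidence M u i) (incidence M u j)         ≡⟨ sym (cong₂ _++_
     (cong₂ letters (incidence-map-zero M u i) (incidence-map-zero M u j))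
     (word-cong K (incidence-map-suc M u i) (incidence-map-suc M u j))) ⟩
  word (suc K) (incidence M (Vec.map suc u) i) (incidence M (Vec.map suc u) j) ∎
  where open ≡-Reasoning
pairWord-incidence {K = suc K} (x ∷ M) {i = i} {j} i≢j (stay {u = u} mono) h
  with x ≟ i | x ≟ j | (h zero) | pairWord-incidence M i≢j mono (λ p → ≤-trans (+-mono-≤ (m≤n+m _ (δ x i * δ zero p)) (m≤n+m _ (δ x j * δ zero p))) (h p))
... | yes refl | yes refl | _ | _ = ⊥-elim (i≢j refl)
... | yes refl | no _ | _ | ih = cong (true ∷_) ih
... | no _ | yes refl | h₀ | ih = trans (cong (false ∷_) ih)
        (cong (_++ word K (incidence M u i ∘ suc) (incidence M u x ∘ suc)) (false∷letters (incidence M u i zero) (incidence M u x zero) h₀))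
  where
  false∷letters : ∀ a b → a + suc b ≤ 1 → false ∷ letters a b ≡ letters a (suc b)
  false∷letters zero    b h       = refl
  false∷letters (suc a) b (s≤s h) = ⊥-elim (m+1+n≰m 0 (≤-trans (m≤n+m (suc b) a) h))
... | no _ | no _ | _ | ih = ih

pairWord-template : ∀ {k K} (T : Vec (Fin k) K) {τ τ′} → τ ≢ τ′ →
  pairWord T τ τ′ ≡ word K (λ p → δ (lookup T p) τ) (λ p → δ (lookup T p) τ′)
pairWord-template []      τ≢τ′ = refl
pairWord-template (x ∷ T) {τ} {τ′} τ≢τ′ with x ≟ τ | x ≟ τ′
... | yes refl | yes refl = ⊥-elim (τ≢τ′ refl)
... | yes _    | no _     = cong (true ∷_) (pairWord-template T τ≢τ′)
... | no _     | yes _    = cong (false ∷_) (pairWord-template T τ≢τ′)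
... | no _     | no _     = pairWord-template T τ≢τ′

module _ {r k K : ℕ} (T : Vec (Fin k) K) (T-matching : Matching r T) (r≥1 : 1 ≤ r) where
  open Template T T-matching r≥1

  -- The word of two hitting labels depends only on which intervals contain their points, and these
  -- are the template points of the two edges they hit.
  hits-clique : ∀ {n m a g} P {u : Vec (Fin K) m} {M : Vec (Fin n) m} → Monotone u →
    (∀ τ τ′ → τ ≢ τ′ → Forms P T τ τ′) → (H : Hits u a g M) → IsCliqueIn P M (Hits.labels H)
  hits-clique P {u} {M} mono forms H i j i∈ j∈ i≢j =
    [ (λ e → inj₁ (trans (same i∈ j∈ i≢j) e)) , (λ e → inj₂ (trans (same j∈ i∈ (i≢j ∘ sym)) e)) ]′
      (forms (edgeOf i∈) (edgeOf j∈) (λ e → i≢j (edgeOf-injective i∈ j∈ e)))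
    where
    open Hits H
    same : ∀ {i j} (i∈ : i ∈ labels) (j∈ : j ∈ labels) → i ≢ j → pairWord M i j ≡ pairWord T (edgeOf i∈) (edgeOf j∈)
    same {i} {j} i∈ j∈ i≢j = begin
      pairWord M i j                                      ≡⟨ pairWord-incidence M i≢j mono disjoint ⟩
      word K (incidence M u i) (incidence M u j)          ≡⟨ word-cong K (incident i∈) (incident j∈) ⟩
      word K (edge (edgeOf i∈)) (edge (edgeOf j∈))        ≡⟨ pairWord-template T τ≢τ′ ⟨
      pairWord T (edgeOf i∈) (edgeOf j∈)                  ∎
      where
      open ≡-Reasoning
      τ≢τ′ : edgeOf i∈ ≢ edgeOf j∈
      τ≢τ′ e = i≢j (edgeOf-injective i∈ j∈ e)
      disjoint : ∀ p → incidence M u i p + incidence M u j p ≤ 1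
      disjoint p = subst₂ (λ x y → x + y ≤ 1) (sym (incident i∈ p)) (sym (incident j∈ p)) δ+δ≤1
        where
        δ+δ≤1 : edge (edgeOf i∈) p + edge (edgeOf j∈) p ≤ 1
        δ+δ≤1 with lookup T p ≟ edgeOf i∈ | lookup T p ≟ edgeOf j∈
        ... | yes e | yes e′ = ⊥-elim (τ≢τ′ (trans (sym e) e′))
        ... | yes _ | no _   = ≤-refl
        ... | no _  | yes _  = ≤-refl
        ... | no _  | no _   = z≤n

-- Equidistribution of subwords

_≟L_ : ∀ {k} (w w′ : List (Fin k)) → Dec (w ≡ w′)
_≟L_ = ≡-dec _≟_

multiplicity-fromList-toList : ∀ {m n} (v : Vec (Fin n) m) i → multiplicity (fromList (toList v)) i ≡ multiplicity v i
multiplicity-fromList-toList []      i = refl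
multiplicity-fromList-toList (x ∷ v) i = cong (δ x i +_) (multiplicity-fromList-toList v i)

ind-∷ : ∀ {k} (a b : Fin k) w w′ → ind ((a ∷ w) ≟L (b ∷ w′)) ≡ δ a b * ind (w ≟L w′)
ind-∷ a b w w′ = by-cases (a ≟ b) (w ≟L w′)
  where
  by-cases : (d : Dec (a ≡ b)) (d′ : Dec (w ≡ w′)) → ind ((a ∷ w) ≟L (b ∷ w′)) ≡ ind d * ind d′
  by-cases (yes e) (yes e′) = ind-yes _ (cong₂ _∷_ e e′)
  by-cases (yes e) (no ¬e′) = ind-no _ (¬e′ ∘ ∷-injectiveʳ)
  by-cases (no ¬e) d′       = ind-no _ (¬e ∘ ∷-injectiveˡ)

∑-toList≤1 : ∀ m {n} (w : List (Fin n)) → ∑ (allVecs m n) (λ v → ind (w ≟L toList v)) ≤ 1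
∑-toList≤1 zero    []      = ≤-refl
∑-toList≤1 zero    (y ∷ w) = z≤n
∑-toList≤1 (suc m) {n} []  = ≤-trans (≤-reflexive (trans (∑-allVecs-suc {m} {n} (λ v → ind ([] ≟L toList v)))
  (∑-0 (allVecs m n) (λ v → ∑-0 (allFin n) (λ x → refl))))) z≤n
∑-toList≤1 (suc m) {n} (y ∷ w) = begin
  ∑ (allVecs (suc m) n) (λ v → ind ((y ∷ w) ≟L toList v))
    ≡⟨ ∑-allVecs-suc {m} {n} (λ v → ind ((y ∷ w) ≟L toList v)) ⟩
  ∑ (allVecs m n) (λ v → ∑ (allFin n) (λ x → ind ((y ∷ w) ≟L (x ∷ toList v))))
    ≡⟨ ∑-cong (allVecs m n) (λ v → ∑-cong (allFin n) (λ x → ind-∷ y x w (toList v))) ⟩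
  ∑ (allVecs m n) (λ v → ∑ (allFin n) (λ x → δ y x * ind (w ≟L toList v)))
    ≡⟨ ∑-cong (allVecs m n) (λ v → trans (∑-*ʳ (allFin n) _ (δ y))
         (trans (cong (_* ind (w ≟L toList v)) (∑-δ y)) (*-identityˡ _))) ⟩
  ∑ (allVecs m n) (λ v → ind (w ≟L toList v))
    ≤⟨ ∑-toList≤1 m w ⟩
  1 ∎
  where
  open ≤-Reasoning

module Subword {n k : ℕ} (s : Vec (Fin n) k) (s-injective : ∀ a b → lookup s a ≡ lookup s b → a ≡ b) where

  index? : (x : Fin n) → Dec (∃ λ a → lookup s a ≡ x)
  index? x = any? (λ a → lookup s a ≟ x)

  -- A list, since its length depends on `v`; only the matching property fixes it to `k * r`.
  subword : ∀ {m} → Vec (Fin n) m → List (Fin k)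
  subword []      = []
  subword (x ∷ v) with index? x
  ... | yes (a , _) = a ∷ subword v
  ... | no _        = subword v

  others : ∀ {m} → Vec (Fin n) m → List (Fin n)
  others []      = []
  others (x ∷ v) with index? x
  ... | yes _ = others v
  ... | no _  = x ∷ others v

  δ-lookup : ∀ a b → δ (lookup s a) (lookup s b) ≡ δ a b
  δ-lookup a b = ind-cong (lookup s a ≟ lookup s b) (a ≟ b) (s-injective a b) (cong (lookup s))

  multiplicity-subword : ∀ {m} (v : Vec (Fin n) m) a →
    multiplicity v (lookup s a) ≡ multiplicity (fromList (subword v)) a
  multiplicity-subword []      a = refl
  multiplicity-subword (x ∷ v) a with index? x
  ... | yes (b , refl) = cong₂ _+_ (δ-lookup b a) (multiplicity-subword v a)
  ... | no ¬s          = trans (cong (_+ multiplicity v (lookup s a)) (δ-≢ (λ e → ¬s (a , sym e)))) (multiplicity-subword v a)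

  multiplicity-others : ∀ {m} (v : Vec (Fin n) m) y → ¬ (∃ λ a → lookup s a ≡ y) →
    multiplicity v y ≡ multiplicity (fromList (others v)) y
  multiplicity-others []      y ¬y = refl
  multiplicity-others (x ∷ v) y ¬y with index? x
  ... | yes (b , e) = trans (cong (_+ multiplicity v y) (δ-≢ (λ e′ → ¬y (b , trans e e′)))) (multiplicity-others v y ¬y)
  ... | no _        = cong (δ x y +_) (multiplicity-others v y ¬y)

  pairWord-subword : ∀ {m} (v : Vec (Fin n) m) a b →
    pairWord v (lookup s a) (lookup s b) ≡ pairWord (fromList (subword v)) a b
  pairWord-subword []      a b = refl
  pairWord-subword (x ∷ v) a b with index? x
  pairWord-subword (x ∷ v) a b | no ¬s with x ≟ lookup s a | x ≟ lookup s b
  ... | yes e | _     = ⊥-elim (¬s (a , sym e))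
  ... | no _  | yes e = ⊥-elim (¬s (b , sym e))
  ... | no _  | no _  = pairWord-subword v a b
  pairWord-subword (x ∷ v) a b | yes (c , refl)
    with lookup s c ≟ lookup s a | lookup s c ≟ lookup s b | c ≟ a | c ≟ b
  ... | yes e | _     | no ¬e | _     = ⊥-elim (¬e (s-injective c a e))
  ... | no ¬e | _     | yes e | _     = ⊥-elim (¬e (cong (lookup s) e))
  ... | no _  | yes e | no _  | no ¬e = ⊥-elim (¬e (s-injective c b e))
  ... | no _  | no ¬e | no _  | yes e = ⊥-elim (¬e (cong (lookup s) e))
  ... | yes _ | _     | yes _ | _     = cong (true ∷_) (pairWord-subword v a b)
  ... | no _  | yes _ | no _  | yes _ = cong (false ∷_) (pairWord-subword v a b)
  ... | no _  | no _  | no _  | no _  = pairWord-subword v a b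

  -- The weight `φ` on the letters outside `s` is arbitrary, because the induction absorbs each such
  -- letter into it.
  weight : ∀ m → List (Fin k) → (List (Fin n) → ℕ) → ℕ
  weight m w φ = ∑ (allVecs m n) (λ v → ind (subword v ≟L w) * φ (others v))

  weight-at : ∀ m → List (Fin k) → (List (Fin n) → ℕ) → Fin n → ℕ
  weight-at m w φ x = ∑ (allVecs m n) (λ v → ind (subword (x ∷ v) ≟L w) * φ (others (x ∷ v)))

  weight-suc : ∀ m w φ → weight (suc m) w φ ≡ ∑ (allFin n) (weight-at m w φ)
  weight-suc m w φ = trans (∑-allVecs-suc {m} (λ v → ind (subword v ≟L w) * φ (others v)))
    (∑-swap (allVecs m n) (allFin n) _)

  weight-other : ∀ m → List (Fin k) → (List (Fin n) → ℕ) → Fin n → ℕ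
  weight-other m w φ x with index? x
  ... | yes _ = 0
  ... | no _  = weight m w (λ l → φ (x ∷ l))

  weight-at-∷ : ∀ m b w φ x →
    weight-at m (b ∷ w) φ x ≡ δ (lookup s b) x * weight m w φ + weight-other m (b ∷ w) φ x
  weight-at-∷ m b w φ x with index? x
  ... | no ¬s = cong (λ d → d * weight m w φ + weight m (b ∷ w) (λ l → φ (x ∷ l))) (sym (δ-≢ (λ e → ¬s (b , e))))
  ... | yes (a , refl) = begin
    ∑ (allVecs m n) (λ v → ind ((a ∷ subword v) ≟L (b ∷ w)) * φ (others v))
      ≡⟨ ∑-cong (allVecs m n) (λ v → trans (cong (_* φ (others v)) (ind-∷ a b (subword v) w)) (*-assoc (δ a b) _ _)) ⟩
    ∑ (allVecs m n) (λ v → δ a b * (ind (subword v ≟L w) * φ (others v)))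
      ≡⟨ ∑-*ˡ (allVecs m n) (δ a b) _ ⟩
    δ a b * weight m w φ
      ≡⟨ cong (_* weight m w φ) (trans (δ-sym a b) (sym (δ-lookup b a))) ⟩
    δ (lookup s b) (lookup s a) * weight m w φ
      ≡⟨ +-identityʳ _ ⟨
    δ (lookup s b) (lookup s a) * weight m w φ + 0 ∎
    where open ≡-Reasoning

  -- Split by the first letter of the long word. Exactly one letter continues the subword, whatever
  -- the entry required there; a letter outside `s` goes into `φ` and leaves the subword as it is.
  -- Neither contribution sees more of the subword than its length.
  weight-length : ∀ m w w′ φ → length w ≡ length w′ → weight m w φ ≡ weight m w′ φ
  weight-other-length : ∀ m w w′ φ x → length w ≡ length w′ → weight-other m w φ x ≡ weight-other m w′ φ x
  weight-length m       []      []        φ e = refl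
  weight-length zero    (b ∷ w) (b′ ∷ w′) φ e = refl
  weight-length (suc m) (b ∷ w) (b′ ∷ w′) φ e = begin
    weight (suc m) (b ∷ w) φ
      ≡⟨ first b w ⟩
    weight m w φ + ∑ (allFin n) (weight-other m (b ∷ w) φ)
      ≡⟨ cong₂ _+_ (weight-length m w w′ φ (ℕP.suc-injective e))
           (∑-cong (allFin n) (λ x → weight-other-length m (b ∷ w) (b′ ∷ w′) φ x e)) ⟩
    weight m w′ φ + ∑ (allFin n) (weight-other m (b′ ∷ w′) φ)
      ≡⟨ first b′ w′ ⟨
    weight (suc m) (b′ ∷ w′) φ ∎
    where
    open ≡-Reasoning
    first : ∀ b w → weight (suc m) (b ∷ w) φ ≡ weight m w φ + ∑ (allFin n) (weight-other m (b ∷ w) φ)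
    first b w = begin
      weight (suc m) (b ∷ w) φ
        ≡⟨ weight-suc m (b ∷ w) φ ⟩
      ∑ (allFin n) (weight-at m (b ∷ w) φ)
        ≡⟨ ∑-cong (allFin n) (weight-at-∷ m b w φ) ⟩
      ∑ (allFin n) (λ x → δ (lookup s b) x * weight m w φ + weight-other m (b ∷ w) φ x)
        ≡⟨ ∑-+ (allFin n) _ _ ⟩
      ∑ (allFin n) (λ x → δ (lookup s b) x * weight m w φ) + ∑ (allFin n) (weight-other m (b ∷ w) φ)
        ≡⟨ cong (_+ ∑ (allFin n) (weight-other m (b ∷ w) φ)) (trans (∑-*ʳ (allFin n) (weight m w φ) (δ (lookup s b)))
             (trans (cong (_* weight m w φ) (∑-δ (lookup s b))) (*-identityˡ _))) ⟩
      weight m w φ + ∑ (allFin n) (weight-other m (b ∷ w) φ) ∎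
  weight-other-length m w w′ φ x e with index? x
  ... | yes _ = refl
  ... | no _  = weight-length m w w′ (λ l → φ (x ∷ l)) e

  othersMatch? : ∀ r (l : List (Fin n)) → Dec (∀ y → ¬ (∃ λ a → lookup s a ≡ y) → multiplicity (fromList l) y ≡ r)
  othersMatch? r l = all? (λ y → ¬? (index? y) →-dec (multiplicity (fromList l) y ℕP.≟ r))

  -- All words of length kr are equally frequent as subwords on s, and matchings# r k of them
  -- are subwords of matchings.
  subword-rare : ∀ {r m} w → length w ≡ k * r → m ≡ n * r →
    ∑ (allVecs m n) (λ M → ind (subword M ≟L w) * ind (matching? r M)) * matchings# r k ≤ matchings# r n
  subword-rare {r} {m} w |w| e = begin
    ∑ (allVecs m n) (λ M → ind (subword M ≟L w) * ind (matching? r M)) * matchings# r k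
      -- Keeping the matching condition only for labels outside `s` turns it into a weight on
      -- `others`, to which `weight-length` applies.
      ≤⟨ *-monoˡ-≤ (matchings# r k) (∑-mono (allVecs m n) (λ M → *-monoʳ-≤ (ind (subword M ≟L w))
           (ind-mono (matching? r M) (othersMatch? r (others M)) (others-match M)))) ⟩
    weight m w φ * matchings# r k
      ≡⟨ trans (*-comm (weight m w φ) (matchings# r k)) (cong (_* weight m w φ) (sym (∑-matching k refl))) ⟩
    ∑ (allVecs (k * r) k) (λ v → ind (matching? r v)) * weight m w φ
      ≡⟨ ∑-*ʳ (allVecs (k * r) k) (weight m w φ) _ ⟨
    ∑ (allVecs (k * r) k) (λ v → ind (matching? r v) * weight m w φ)
      ≡⟨ ∑-cong (allVecs (k * r) k) (λ v → cong (ind (matching? r v) *_)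
           (weight-length m w (toList v) φ (trans |w| (sym (length-toList v))))) ⟩
    ∑ (allVecs (k * r) k) (λ v → ind (matching? r v) * weight m (toList v) φ)
      ≡⟨ ∑-cong (allVecs (k * r) k) (λ v → sym (∑-*ˡ (allVecs m n) (ind (matching? r v)) _)) ⟩
    ∑ (allVecs (k * r) k) (λ v → ∑ (allVecs m n) (λ M →
      ind (matching? r v) * (ind (subword M ≟L toList v) * φ (others M))))
      ≡⟨ ∑-swap (allVecs (k * r) k) (allVecs m n) _ ⟩
    ∑ (allVecs m n) (λ M → ∑ (allVecs (k * r) k) (λ v →
      ind (matching? r v) * (ind (subword M ≟L toList v) * φ (others M))))
      ≤⟨ ∑-mono (allVecs m n) at-most-once ⟩
    ∑ (allVecs m n) (λ M → ind (matching? r M))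
      ≡⟨ ∑-matching n e ⟩
    matchings# r n ∎
    where
    open ≤-Reasoning
    φ : List (Fin n) → ℕ
    φ l = ind (othersMatch? r l)
    others-match : ∀ M → Matching r M → ∀ y → ¬ (∃ λ a → lookup s a ≡ y) → multiplicity (fromList (others M)) y ≡ r
    others-match M h y ¬y = trans (sym (multiplicity-others M y ¬y)) (h y)
    -- The part of the matching condition that was dropped comes back from `v`, which prescribes the
    -- multiplicities of the labels in `s`.
    glue : ∀ (M : Vec (Fin n) m) (v : Vec (Fin k) (k * r)) → Matching r v → subword M ≡ toList v →
      (∀ y → ¬ (∃ λ a → lookup s a ≡ y) → multiplicity (fromList (others M)) y ≡ r) → Matching r M
    glue M v h e′ h′ x with index? x
    ... | yes (a , refl) = trans (multiplicity-subword M a) (trans (cong (λ l → multiplicity (fromList l) a) e′)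
                             (trans (multiplicity-fromList-toList v a) (h a)))
    ... | no ¬x          = trans (multiplicity-others M x ¬x) (h′ x ¬x)
    at-most-once : ∀ M → ∑ (allVecs (k * r) k) (λ v →
      ind (matching? r v) * (ind (subword M ≟L toList v) * φ (others M))) ≤ ind (matching? r M)
    at-most-once M = ≤-trans (∑-mono (allVecs (k * r) k) bound)
      (≤-trans (≤-reflexive (∑-*ʳ (allVecs (k * r) k) (ind (matching? r M)) (λ v → ind (subword M ≟L toList v))))
        (≤-trans (*-monoˡ-≤ (ind (matching? r M)) (∑-toList≤1 (k * r) (subword M))) (≤-reflexive (*-identityˡ _))))
      where
      bound : ∀ v → ind (matching? r v) * (ind (subword M ≟L toList v) * φ (others M))
                  ≤ ind (subword M ≟L toList v) * ind (matching? r M)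
      bound v with matching? r v | subword M ≟L toList v | othersMatch? r (others M)
      ... | no _  | _      | _     = z≤n
      ... | yes _ | no _   | _     = z≤n
      ... | yes _ | yes _  | no _  = z≤n
      ... | yes h | yes e′ | yes h′ = ≤-reflexive (sym (trans (*-identityˡ _) (ind-yes (matching? r M) (glue M v h e′ h′))))

-- Large cliques

-- At the first position where the two words differ, say with letters `x` and `y`, their words for
-- the pair `x`, `y` continue with opposite letters, in either orientation. Hence one orientation
-- per pair is enough.
pairWord-determines : ∀ {k} (w w′ : List (Fin k)) → length w ≡ length w′ →
  (∀ a b → a ≢ b → pairWord (fromList w) a b ≡ pairWord (fromList w′) a b
                 ⊎ pairWord (fromList w) b a ≡ pairWord (fromList w′) b a) → w ≡ w′
pairWord-determines []      []       _ _ = refl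
pairWord-determines (x ∷ w) (y ∷ w′) e h with x ≟ y
... | yes refl = cong (x ∷_) (pairWord-determines w w′ (ℕP.suc-injective e)
        (λ a b a≢b → [ inj₁ ∘ strip a b , inj₂ ∘ strip b a ]′ (h a b a≢b)))
  where
  strip : ∀ a b → pairWord (fromList (x ∷ w)) a b ≡ pairWord (fromList (x ∷ w′)) a b →
    pairWord (fromList w) a b ≡ pairWord (fromList w′) a b
  strip a b e with x ≟ a | x ≟ b
  ... | yes _ | _     = ∷-injectiveʳ e
  ... | no _  | yes _ = ∷-injectiveʳ e
  ... | no _  | no _  = e
... | no x≢y = ⊥-elim ([ clash , clash′ ]′ (h x y x≢y))
  where
  clash : pairWord (fromList (x ∷ w)) x y ≢ pairWord (fromList (y ∷ w′)) x y
  clash e with x ≟ x | y ≟ x | y ≟ y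
  ... | no ¬e | _     | _     = ¬e refl
  ... | yes _ | yes q | _     = x≢y (sym q)
  ... | yes _ | no _  | no ¬e = ¬e refl
  clash e | yes _ | no _ | yes _ with () ← e
  clash′ : pairWord (fromList (x ∷ w)) y x ≢ pairWord (fromList (y ∷ w′)) y x
  clash′ e with x ≟ y | x ≟ x | y ≟ y
  ... | yes q | _     | _     = x≢y q
  ... | no _  | no ¬e | _     = ¬e refl
  ... | no _  | yes _ | no ¬e = ¬e refl
  clash′ e | no _ | yes _ | yes _ with () ← e

-- The order of an edge pair in a P-clique in which the first point of i precedes that of j.
Precedes : ∀ {m n} → List Bool → Vec (Fin n) m → Fin n → Fin n → Set
Precedes []          M i j = pairWord M i j ≡ []
Precedes (true ∷ P)  M i j = pairWord M i j ≡ true ∷ P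
Precedes (false ∷ P) M i j = pairWord M j i ≡ false ∷ P

precedes? : ∀ {m n} P (M : Vec (Fin n) m) i j → Dec (Precedes P M i j)
precedes? []          M i j = ≡-dec BoolP._≟_ _ _
precedes? (true ∷ P)  M i j = ≡-dec BoolP._≟_ _ _
precedes? (false ∷ P) M i j = ≡-dec BoolP._≟_ _ _

Chain : ∀ {m n k} → List Bool → Vec (Fin n) m → Vec (Fin n) k → Set
Chain P M s = ∀ a b → a Fin.< b → Precedes P M (lookup s a) (lookup s b)

chain? : ∀ {m n k} P (M : Vec (Fin n) m) (s : Vec (Fin n) k) → Dec (Chain P M s)
chain? P M s = all? (λ a → all? (λ b → (a FinP.<? b) →-dec precedes? P M (lookup s a) (lookup s b)))

-- Take the label of the first point whose label lies in `S`; the nonzero multiplicity of `j`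
-- ensures that there is such a point.
first-label : ∀ {m n} (M : Vec (Fin n) m) (S : Subset n) {j} → j ∈ S → multiplicity M j ≢ 0 →
  ∃ λ i → i ∈ S × ∀ j → j ∈ S → i ≢ j →
    (∃ λ w → pairWord M i j ≡ true ∷ w) × (∃ λ w → pairWord M j i ≡ false ∷ w)
first-label []      S j∈ h = ⊥-elim (h refl)
first-label (x ∷ M) S {j} j∈ h with x ∈? S
... | yes x∈ = x , x∈ , leads
  where
  leads : ∀ j → j ∈ S → x ≢ j →
    (∃ λ w → pairWord (x ∷ M) x j ≡ true ∷ w) × (∃ λ w → pairWord (x ∷ M) j x ≡ false ∷ w)
  leads j j∈ x≢j with x ≟ x | x ≟ j
  ... | no ¬e | _     = ⊥-elim (¬e refl)
  ... | yes _ | yes e = ⊥-elim (x≢j e)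
  ... | yes _ | no _  = (_ , refl) , (_ , refl)
... | no x∉ with first-label M S j∈ (λ e → h (trans (cong (_+ multiplicity M j) (δ-≢ (λ e′ → x∉ (subst (_∈ S) (sym e′) j∈)))) e))
...   | i , i∈ , leads = i , i∈ , λ j j∈ i≢j → map (map id (trans (skip i j i∈ j∈))) (map id (trans (skip j i j∈ i∈))) (leads j j∈ i≢j)
  where
  skip : ∀ i j → i ∈ S → j ∈ S → pairWord (x ∷ M) i j ≡ pairWord M i j
  skip i j i∈ j∈ with x ≟ i | x ≟ j
  ... | yes e | _     = ⊥-elim (x∉ (subst (_∈ S) (sym e) i∈))
  ... | no _  | yes e = ⊥-elim (x∉ (subst (_∈ S) (sym e) j∈))
  ... | no _  | no _  = refl

∣p∣≤1+∣p∖x∣ : ∀ {n} (p : Subset n) x → ∣ p ∣ ≤ suc ∣ p ∖ x ∣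
∣p∣≤1+∣p∖x∣ (outside ∷ p) zero    = ≤-trans (≤-reflexive (cong ∣_∣ (sym (p─⊥≡p p)))) (n≤1+n _)
∣p∣≤1+∣p∖x∣ (inside ∷ p)  zero    = s≤s (≤-reflexive (cong ∣_∣ (sym (p─⊥≡p p))))
∣p∣≤1+∣p∖x∣ (outside ∷ p) (suc x) = ∣p∣≤1+∣p∖x∣ p x
∣p∣≤1+∣p∖x∣ (inside ∷ p)  (suc x) = s≤s (∣p∣≤1+∣p∖x∣ p x)

x∈p∖y⇒x≢y : ∀ {n} {p : Subset n} {x y} → x ∈ p ∖ y → x ≢ y
x∈p∖y⇒x≢y {p = b ∷ p} {y = zero}  ()        refl
x∈p∖y⇒x≢y {p = b ∷ p} {y = suc y} (there h) refl = x∈p∖y⇒x≢y h refl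

-- Repeatedly remove the label with the earliest point. Its pair words with all remaining labels
-- begin with a known letter, which decides between the two alternatives in `Forms`.
clique-chain : ∀ {r m n} P (M : Vec (Fin n) m) → 1 ≤ r → Matching r M → ∀ k (S : Subset n) →
  IsCliqueIn P M S → k ≤ ∣ S ∣ → ∃ λ (s : Vec (Fin n) k) → Chain P M s × ∀ a → lookup s a ∈ S
clique-chain P M r≥1 h zero    S clique k≤ = [] , (λ ()) , λ ()
clique-chain {r} {n = n} P M r≥1 h (suc k) S clique k≤ with nonempty? S
... | no ¬ne = ⊥-elim (1+n≰n (≤-trans (≤-trans (s≤s z≤n) k≤) (≤-reflexive (trans (cong ∣_∣ (Empty-unique ¬ne)) (∣⊥∣≡0 n)))))
... | yes (j , j∈) with first-label M S j∈ (λ e → <⇒≢ r≥1 (trans (sym e) (h j)))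
...   | i , i∈ , leads with clique-chain P M r≥1 h k (S ∖ i)
          (λ a b a∈ b∈ → clique a b (p─q⊆p S ⁅ i ⁆ a∈) (p─q⊆p S ⁅ i ⁆ b∈)) (s≤s⁻¹ (≤-trans k≤ (∣p∣≤1+∣p∖x∣ S i)))
...     | s , chain , s∈ = i ∷ s , chain′ , λ { zero → i∈ ; (suc a) → p─q⊆p S ⁅ i ⁆ (s∈ a) }
  where
  precedes : ∀ P j → Forms P M i j → (∃ λ w → pairWord M i j ≡ true ∷ w) × (∃ λ w → pairWord M j i ≡ false ∷ w) →
    Precedes P M i j
  precedes []          j (inj₁ e) _ = e
  precedes []          j (inj₂ e) (_ , _ , e′) with () ← trans (sym e) e′
  precedes (true ∷ P)  j (inj₁ e) _ = e
  precedes (true ∷ P)  j (inj₂ e) (_ , _ , e′) with () ← trans (sym e) e′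
  precedes (false ∷ P) j (inj₁ e) ((_ , e′) , _) with () ← trans (sym e) e′
  precedes (false ∷ P) j (inj₂ e) _ = e
  chain′ : Chain P M (i ∷ s)
  chain′ zero    (suc b) _ = precedes P (lookup s b) (clique i (lookup s b) i∈ b∈ i≢b) (leads (lookup s b) b∈ i≢b)
    where
    b∈ : lookup s b ∈ S
    b∈ = p─q⊆p S ⁅ i ⁆ (s∈ b)
    i≢b : i ≢ lookup s b
    i≢b = x∈p∖y⇒x≢y (s∈ b) ∘ sym
  chain′ (suc a) (suc b) (s≤s a<b) = chain a b a<b

occ-false-self : ∀ {m n} (M : Vec (Fin n) m) i → occ false (pairWord M i i) ≡ 0
occ-false-self []      i = refl
occ-false-self (x ∷ M) i with x ≟ i
... | yes _ = occ-false-self M i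
... | no _  = occ-false-self M i

-- The union bound over chains.

module _ {r : ℕ} (r≥1 : 1 ≤ r) (P : List Bool) (P-pattern : IsRPattern r P) where

  -- The word of a label with itself has no letter B, while `P` has `r` of them. This makes the
  -- entries of a chain distinct, as `Subword` demands.
  precedes-irrefl : ∀ {m n} (M : Vec (Fin n) m) i → ¬ Precedes P M i i
  precedes-irrefl M i h = <⇒≢ r≥1 (trans (sym (occ-false-self M i)) (trans (cong (occ false) (self P h)) (proj₂ P-pattern)))
    where
    self : ∀ P → Precedes P M i i → pairWord M i i ≡ P
    self []          e = e
    self (true ∷ P)  e = e
    self (false ∷ P) e = e

  chain-injective : ∀ {m n k} {M : Vec (Fin n) m} {s : Vec (Fin n) k} → Chain P M s →
    ∀ a b → lookup s a ≡ lookup s b → a ≡ b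
  chain-injective {M = M} {s} h a b e with FinP.<-cmp a b
  ... | tri< a<b _ _ = ⊥-elim (precedes-irrefl M _ (subst (Precedes P M (lookup s a)) (sym e) (h a b a<b)))
  ... | tri≈ _ a≡b _ = a≡b
  ... | tri> _ _ b<a = ⊥-elim (precedes-irrefl M _ (subst (Precedes P M (lookup s b)) e (h b a b<a)))

  -- The subword that a chain forces is not computed from `P`. If some matching makes `s` a chain,
  -- its subword `w` is the reference, and every other such matching shares it; otherwise the count
  -- is zero.
  chain-rare : ∀ {m} n k (s : Vec (Fin n) k) → m ≡ n * r →
    ∑ (allVecs m n) (λ M → ind (matching? r M ×-dec chain? P M s)) * matchings# r k ≤ matchings# r n
  chain-rare {m} n k s e with ∑-zero-or-witness (allVecs m n) (λ M → ind (matching? r M ×-dec chain? P M s))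
  ... | inj₁ e₀ = ≤-trans (≤-reflexive (cong (_* matchings# r k) e₀)) z≤n
  ... | inj₂ (M₀ , ≢0) = ≤-trans (*-monoˡ-≤ (matchings# r k) (∑-mono (allVecs m n) bound))
          (subword-rare w (|subword| M₀ (proj₁ good₀)) e)
    where
    good₀ : Matching r M₀ × Chain P M₀ s
    good₀ = ind≢0 (matching? r M₀ ×-dec chain? P M₀ s) ≢0
    open Subword s (chain-injective {M = M₀} {s} (proj₂ good₀))
    w : List (Fin k)
    w = subword M₀
    |subword| : ∀ (M : Vec (Fin n) m) → Matching r M → length (subword M) ≡ k * r
    |subword| M h = matching-size (fromList (subword M)) (λ a → trans (sym (multiplicity-subword M a)) (h (lookup s a)))
    agree : ∀ P i j (M M′ : Vec (Fin n) m) → Precedes P M i j → Precedes P M′ i j →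
      pairWord M i j ≡ pairWord M′ i j ⊎ pairWord M j i ≡ pairWord M′ j i
    agree []          i j M M′ h h′ = inj₁ (trans h (sym h′))
    agree (true ∷ P)  i j M M′ h h′ = inj₁ (trans h (sym h′))
    agree (false ∷ P) i j M M′ h h′ = inj₂ (trans h (sym h′))
    same-subword : ∀ M → Matching r M → Chain P M s → subword M ≡ w
    same-subword M h chain = pairWord-determines (subword M) w (trans (|subword| M h) (sym (|subword| M₀ (proj₁ good₀)))) pairs
      where
      transfer : ∀ a b → pairWord M (lookup s a) (lookup s b) ≡ pairWord M₀ (lookup s a) (lookup s b) →
        pairWord (fromList (subword M)) a b ≡ pairWord (fromList w) a b
      transfer a b e = trans (sym (pairWord-subword M a b)) (trans e (pairWord-subword M₀ a b))
      pairs : ∀ a b → a ≢ b → pairWord (fromList (subword M)) a b ≡ pairWord (fromList w) a b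
                            ⊎ pairWord (fromList (subword M)) b a ≡ pairWord (fromList w) b a
      pairs a b a≢b with FinP.<-cmp a b
      ... | tri< a<b _ _ = [ inj₁ ∘ transfer a b , inj₂ ∘ transfer b a ]′
              (agree P _ _ M M₀ (chain a b a<b) (proj₂ good₀ a b a<b))
      ... | tri≈ _ a≡b _ = ⊥-elim (a≢b a≡b)
      ... | tri> _ _ b<a = [ inj₂ ∘ transfer b a , inj₁ ∘ transfer a b ]′
              (agree P _ _ M M₀ (chain b a b<a) (proj₂ good₀ b a b<a))
    bound : ∀ M → ind (matching? r M ×-dec chain? P M s) ≤ ind (subword M ≟L w) * ind (matching? r M)
    bound M = by-cases (matching? r M ×-dec chain? P M s)
      where
      by-cases : (d : Dec (Matching r M × Chain P M s)) → ind d ≤ ind (subword M ≟L w) * ind (matching? r M)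
      by-cases (no _) = z≤n
      by-cases (yes (h , c)) = ≤-reflexive (sym (cong₂ _*_ (ind-yes (subword M ≟L w) (same-subword M h c)) (ind-yes (matching? r M) h)))

  large-cliques-union-bound : ∀ {m} n k (f : Vec (Fin n) m → ℕ) → m ≡ n * r → (∀ M → f M ≤ 1) →
    (∀ M → f M ≢ 0 → Matching r M × ∃ λ S → IsCliqueIn P M S × k ≤ ∣ S ∣) →
    ∑ (allVecs m n) f * matchings# r k ≤ n ^ k * matchings# r n
  large-cliques-union-bound {m} n k f e f≤1 large = begin
    ∑ (allVecs m n) f * matchings# r k
      ≤⟨ *-monoˡ-≤ (matchings# r k) (∑-mono (allVecs m n) union) ⟩
    ∑ (allVecs m n) (λ M → ∑ (allVecs k n) (λ s → ind (matching? r M ×-dec chain? P M s))) * matchings# r k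
      ≡⟨ cong (_* matchings# r k) (∑-swap (allVecs m n) (allVecs k n) _) ⟩
    ∑ (allVecs k n) (λ s → ∑ (allVecs m n) (λ M → ind (matching? r M ×-dec chain? P M s))) * matchings# r k
      ≡⟨ ∑-*ʳ (allVecs k n) (matchings# r k) _ ⟨
    ∑ (allVecs k n) (λ s → ∑ (allVecs m n) (λ M → ind (matching? r M ×-dec chain? P M s)) * matchings# r k)
      ≤⟨ ∑-mono (allVecs k n) (λ s → chain-rare n k s e) ⟩
    ∑ (allVecs k n) (λ s → matchings# r n)
      ≡⟨ trans (∑-cong (allVecs k n) (λ _ → sym (*-identityˡ _))) (∑-*ʳ (allVecs k n) (matchings# r n) (λ _ → 1)) ⟩
    ∑ (allVecs k n) (λ _ → 1) * matchings# r n
      ≡⟨ cong (_* matchings# r n) (length-allVecs k n) ⟩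
    n ^ k * matchings# r n ∎
    where
    open ≤-Reasoning
    union : ∀ M → f M ≤ ∑ (allVecs k n) (λ s → ind (matching? r M ×-dec chain? P M s))
    union M with f M ℕP.≟ 0
    ... | yes f≡0 = ≤-trans (≤-reflexive f≡0) z≤n
    ... | no f≢0 with large M f≢0
    ...   | h , S , clique , k≤ with clique-chain P M r≥1 h k S clique k≤
    ...     | s , chain , _ = ≤-trans (f≤1 M) (≤-trans
                (≤-reflexive (sym (ind-yes (matching? r M ×-dec chain? P M s) (h , chain))))
                (vec-term≤∑ (λ s → ind (matching? r M ×-dec chain? P M s)) s))

-- Choice of the parameters

-- Provides integer `r`-th roots and integer quotients, with the rounding built in.
crossing : (f : ℕ → ℕ) (x N : ℕ) → f 0 ≤ x → x < f N → ∃ λ g → f g ≤ x × x < f (suc g)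
crossing f x zero    lo hi = ⊥-elim (<-irrefl refl (<-≤-trans hi lo))
crossing f x (suc N) lo hi with f N ≤? x
... | yes h = N , h , hi
... | no ¬h = crossing f x N lo (≰⇒> ¬h)

m≤m^n : ∀ m n → 1 ≤ n → m ≤ m ^ n
m≤m^n zero      n       _ = z≤n
m≤m^n m@(suc _) (suc n) _ = m≤m*n m (m ^ n) {{m^n≢0 m n}}

^-cancelˡ-< : ∀ n {a b} → a ^ n < b ^ n → a < b
^-cancelˡ-< n {a} {b} h = ≰⇒> λ b≤a → <-irrefl refl (<-≤-trans h (^-monoˡ-≤ n b≤a))

-- With κ = scale r * g and t = 2g(1+d), where 1+d = 2(8r)^r κ^(r-1), one has 16tr = κ^r ≤ n:
-- the t exposed edges use only a small fraction of the points.
scale : ℕ → ℕ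
scale r = 64 * (r * (8 * r) ^ r)

-- In `16 = 8 * 2` the 8 pays for passing from `k ^ k` to `k !`, and the 2 leaves the gain `2 ^ k`
-- over the `n ^ k` tuples.
large-cliques-rare : ∀ {r m} (r≥1 : 1 ≤ r) P → IsRPattern r P → ∀ n k (f : Vec (Fin n) m → ℕ) → m ≡ n * r → 1 ≤ n →
  16 ^ r * n ≤ k ^ r → (∀ M → f M ≤ 1) →
  (∀ M → f M ≢ 0 → Matching r M × ∃ λ S → IsCliqueIn P M S × k ≤ ∣ S ∣) →
  ∑ (allVecs m n) f * 2 ^ k ≤ matchings# r n
large-cliques-rare {r} {m} r≥1 P P-pattern n@(suc _) k f e n≥1 k-large f≤1 large =
  *-cancelˡ-≤ (n ^ k) {{m^n≢0 n k}} (begin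
    n ^ k * (F * 2 ^ k)            ≡⟨ lem (n ^ k) F (2 ^ k) ⟩
    F * (2 ^ k * n ^ k)            ≡⟨ cong (F *_) (^-distribʳ-* k 2 n) ⟨
    F * (2 * n) ^ k                ≤⟨ *-monoʳ-≤ F (≤-trans many (!^≤matchings# r k)) ⟩
    F * matchings# r k             ≤⟨ large-cliques-union-bound r≥1 P P-pattern n k f e f≤1 large ⟩
    n ^ k * matchings# r n         ∎)
  where
  open ≤-Reasoning
  F : ℕ
  F = ∑ (allVecs m n) f
  lem : ∀ a b c → a * (b * c) ≡ b * (c * a)
  lem = solve-∀
  ^-swap : ∀ x a b → (x ^ a) ^ b ≡ (x ^ b) ^ a
  ^-swap x a b = trans (^-*-assoc x a b) (trans (cong (x ^_) (*-comm a b)) (sym (^-*-assoc x b a)))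
  many : (2 * n) ^ k ≤ (k !) ^ r
  many = *-cancelˡ-≤ ((8 ^ r) ^ k) {{m^n≢0 (8 ^ r) k {{m^n≢0 8 r}}}} (begin
    (8 ^ r) ^ k * (2 * n) ^ k      ≡⟨ ^-distribʳ-* k (8 ^ r) (2 * n) ⟨
    (8 ^ r * (2 * n)) ^ k          ≤⟨ ^-monoˡ-≤ k (begin
       8 ^ r * (2 * n)               ≡⟨ *-assoc (8 ^ r) 2 n ⟨
       8 ^ r * 2 * n                 ≤⟨ *-monoˡ-≤ n (*-monoʳ-≤ (8 ^ r) (m≤m^n 2 r r≥1)) ⟩
       8 ^ r * 2 ^ r * n             ≡⟨ cong (_* n) (^-distribʳ-* r 8 2) ⟨
       16 ^ r * n                    ≤⟨ k-large ⟩
       k ^ r                         ∎) ⟩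
    (k ^ r) ^ k                    ≡⟨ ^-swap k r k ⟩
    (k ^ k) ^ r                    ≤⟨ ^-monoˡ-≤ r (k^k≤8^k*k! k) ⟩
    (8 ^ k * k !) ^ r              ≡⟨ ^-distribʳ-* r (8 ^ k) (k !) ⟩
    (8 ^ k) ^ r * (k !) ^ r        ≡⟨ cong (_* (k !) ^ r) (^-swap 8 k r) ⟩
    (8 ^ r) ^ k * (k !) ^ r        ∎)

-- κ is a quarter of the number of template edges, 2ℓ bounds the length of an interval of
-- points, and t labels are exposed, each of them hitting with probability at least 2/(1+d).
record Parameters (r n g : ℕ) : Set where
  field
    κ ℓ d t : ℕ
    κ≥1     : 1 ≤ κ
    ℓ≥1     : 1 ≤ ℓ
    d≥1     : 1 ≤ d
    g≤κ     : g ≤ κ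
    points≤ : r * n ≤ r * (4 * κ) * (2 * ℓ)
    room    : 2 * ℓ * (r * (4 * κ)) + t * r ≤ r * n + κ * ℓ
    dense   : 2 * (2 * ℓ * (r * (4 * κ))) ^ r ≤ suc d * (κ * ℓ ^ r)
    shrink  : 2 ^ (2 * g) * d ^ t ≤ suc d ^ t

module _ {r : ℕ} (r≥2 : 2 ≤ r) where
  open ≤-Reasoning

  private
    r≥1 : 1 ≤ r
    r≥1 = ≤-trans (s≤s z≤n) r≥2

    instance
      r≢0 : NonZero r
      r≢0 = >-nonZero r≥1

    ^r : ∀ x → x ^ r ≡ x * x ^ (r ∸ 1)
    ^r x = cong (x ^_) (sym (m+[n∸m]≡n r≥1))

    8r^r≥2 : 2 ≤ (8 * r) ^ r
    8r^r≥2 = ≤-trans (≤-trans (s≤s (s≤s z≤n)) (m≤m*n 8 r)) (m≤m^n (8 * r) r r≥1)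

  scale≥128r : 128 * r ≤ scale r
  scale≥128r = begin
    128 * r                   ≡⟨ lem r ⟩
    64 * (r * 2)              ≤⟨ *-monoʳ-≤ 64 (*-monoʳ-≤ r 8r^r≥2) ⟩
    64 * (r * (8 * r) ^ r)    ∎
    where
    lem : ∀ r → 128 * r ≡ 64 * (r * 2)
    lem = solve-∀

  -- First `κ` is a constant multiple of `g`. Then `ℓ` is the least integer above `n / (8 * κ)`, so
  -- that `r * (4 * κ)` intervals of size `2 * ℓ` hold all points. Equality in `dense` fixes `d`,
  -- and `shrink` fixes `t`.
  parameters : ∀ n g → 1 ≤ g → (scale r * g) ^ r ≤ n → Parameters r n g
  parameters n g g≥1 n-large = choose (scale r * g) refl κ≥128r n-large
    where
    instance
      g≢0 : NonZero g
      g≢0 = >-nonZero g≥1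
    κ≥128r : 128 * r ≤ scale r * g
    κ≥128r = ≤-trans scale≥128r (m≤m*n (scale r) g)
    choose : ∀ κ → κ ≡ scale r * g → 128 * r ≤ κ → κ ^ r ≤ n → Parameters r n g
    choose κ κ≡ κ≥128r n-large = with-level (crossing (λ j → 8 * κ * j) n (suc n)
        (≤-trans (≤-reflexive (*-zeroʳ (8 * κ))) z≤n) (m≤n*m (suc n) (8 * κ) {{m*n≢0 8 κ}}))
      where
      κ≥1 : 1 ≤ κ
      κ≥1 = ≤-trans (≤-trans r≥1 (m≤n*m r 128)) κ≥128r
      instance
        κ≢0 : NonZero κ
        κ≢0 = >-nonZero κ≥1
      X y D : ℕ
      X = (8 * r) ^ r
      y = κ ^ (r ∸ 1)
      D = 2 * (X * y)
      D≥2 : 2 ≤ D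
      D≥2 = m≤m*n 2 (X * y) {{m*n≢0 X y {{m^n≢0 (8 * r) r {{m*n≢0 8 r}}}} {{m^n≢0 κ (r ∸ 1)}}}}
      d : ℕ
      d = D ∸ 1
      1+d≡D : suc d ≡ D
      1+d≡D = m+[n∸m]≡n (≤-trans (s≤s z≤n) D≥2)
      with-level : (∃ λ j → 8 * κ * j ≤ n × n < 8 * κ * suc j) → Parameters r n g
      with-level (j , j≤ , <ℓ) = record
        { κ = κ ; ℓ = ℓ ; d = d ; t = suc d * (2 * g)
        ; κ≥1 = κ≥1 ; ℓ≥1 = s≤s z≤n ; d≥1 = m+n≤o⇒m≤o∸n 1 D≥2
        ; g≤κ = ≤-trans (m≤n*m g (scale r) {{>-nonZero (≤-trans (≤-trans r≥1 (m≤n*m r 128)) scale≥128r)}}) (≤-reflexive (sym κ≡))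
        ; points≤ = ≤-trans (*-monoʳ-≤ r (<⇒≤ <ℓ)) (≤-reflexive (lem₀ r κ ℓ))
        ; room = room (suc d * (2 * g) * r) 2tr≤
        ; dense = dense
        ; shrink = shrink
        }
        where
        ℓ : ℕ
        ℓ = suc j
        lem₀ : ∀ r κ ℓ → r * (8 * κ * ℓ) ≡ r * (4 * κ) * (2 * ℓ)
        lem₀ = solve-∀
        lem₁ : ∀ κ ℓ → 8 * κ * ℓ ≡ κ * (8 * ℓ)
        lem₁ = solve-∀
        lem₂ : ∀ κ ℓ → κ * (8 * ℓ) ≡ 8 * (κ * ℓ)
        lem₂ = solve-∀
        κy≤8κℓ : κ * y ≤ κ * (8 * ℓ)
        κy≤8κℓ = begin
          κ * y           ≡⟨ ^r κ ⟨
          κ ^ r           ≤⟨ n-large ⟩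
          n               ≤⟨ <⇒≤ <ℓ ⟩
          8 * κ * ℓ       ≡⟨ lem₁ κ ℓ ⟩
          κ * (8 * ℓ)     ∎
        -- The number 128 is `8 * 16`; the step from `κ` to its power `y` relies on `r≥2`.
        16r≤ℓ : 16 * r ≤ ℓ
        16r≤ℓ = *-cancelˡ-≤ 8 (begin
          8 * (16 * r)     ≡⟨ *-assoc 8 16 r ⟨
          128 * r          ≤⟨ κ≥128r ⟩
          κ                ≤⟨ m≤m^n κ (r ∸ 1) (m+n≤o⇒m≤o∸n 1 r≥2) ⟩
          y                ≤⟨ *-cancelˡ-≤ κ κy≤8κℓ ⟩
          8 * ℓ            ∎)
        -- This equation dictates `scale`: its 64 is `16 * 2 * 2`, the twos coming from `D` and from
        -- `2 * g`.
        16tr≡ : 16 * (suc d * (2 * g) * r) ≡ κ * y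
        16tr≡ = trans (cong (λ D → 16 * (D * (2 * g) * r)) 1+d≡D) (trans (lem r X y g) (cong (_* y) (sym κ≡)))
          where
          lem : ∀ r X y g → 16 * (2 * (X * y) * (2 * g) * r) ≡ 64 * (r * X) * g * y
          lem = solve-∀
        2tr≤ : 2 * (suc d * (2 * g) * r) ≤ κ * ℓ
        2tr≤ = *-cancelˡ-≤ 8 (begin
          8 * (2 * (suc d * (2 * g) * r))     ≡⟨ *-assoc 8 2 (suc d * (2 * g) * r) ⟨
          16 * (suc d * (2 * g) * r)          ≡⟨ 16tr≡ ⟩
          κ * y                               ≤⟨ κy≤8κℓ ⟩
          κ * (8 * ℓ)                         ≡⟨ lem₂ κ ℓ ⟩
          8 * (κ * ℓ)                         ∎)
        -- Rounding up to `ℓ` makes the intervals exceed the `r * n` points by at most `8 * r * κ`,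
        -- and the exposed labels use `x` points. Half of `κ * ℓ` pays for each.
        room : ∀ x → 2 * x ≤ κ * ℓ → 2 * ℓ * (r * (4 * κ)) + x ≤ r * n + κ * ℓ
        room x 2x≤ = *-cancelˡ-≤ 2 (begin
          2 * (2 * ℓ * (r * (4 * κ)) + x)                  ≡⟨ lem r κ j x ⟩
          2 * (r * (8 * κ * j)) + (κ * (16 * r) + 2 * x)   ≤⟨ +-mono-≤ (*-monoʳ-≤ 2 (*-monoʳ-≤ r j≤))
                                                                (+-mono-≤ (*-monoʳ-≤ κ 16r≤ℓ) 2x≤) ⟩
          2 * (r * n) + (κ * ℓ + κ * ℓ)                    ≡⟨ lem′ (r * n) (κ * ℓ) ⟩
          2 * (r * n + κ * ℓ)                              ∎)
          where
          lem : ∀ r κ j x → 2 * (2 * suc j * (r * (4 * κ)) + x) ≡ 2 * (r * (8 * κ * j)) + (κ * (16 * r) + 2 * x)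
          lem = solve-∀
          lem′ : ∀ x y → 2 * x + (y + y) ≡ 2 * (x + y)
          lem′ = solve-∀
        dense : 2 * (2 * ℓ * (r * (4 * κ))) ^ r ≤ suc d * (κ * ℓ ^ r)
        dense = ≤-reflexive (begin-equality
          2 * (2 * ℓ * (r * (4 * κ))) ^ r                ≡⟨ cong (λ x → 2 * x ^ r) (lem r κ ℓ) ⟩
          2 * (8 * r * κ * ℓ) ^ r                        ≡⟨ cong (2 *_) (trans (^-distribʳ-* r (8 * r * κ) ℓ)
                                                              (cong (_* ℓ ^ r) (^-distribʳ-* r (8 * r) κ))) ⟩
          2 * (X * κ ^ r * ℓ ^ r)                        ≡⟨ cong (λ z → 2 * (X * z * ℓ ^ r)) (^r κ) ⟩
          2 * (X * (κ * y) * ℓ ^ r)                      ≡⟨ lem′ X κ y (ℓ ^ r) ⟩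
          D * (κ * ℓ ^ r)                                ≡⟨ cong (_* (κ * ℓ ^ r)) 1+d≡D ⟨
          suc d * (κ * ℓ ^ r)                            ∎)
          where
          lem : ∀ r κ ℓ → 2 * ℓ * (r * (4 * κ)) ≡ 8 * r * κ * ℓ
          lem = solve-∀
          lem′ : ∀ x κ y z → 2 * (x * (κ * y) * z) ≡ 2 * (x * y) * (κ * z)
          lem′ = solve-∀
        shrink : 2 ^ (2 * g) * d ^ (suc d * (2 * g)) ≤ suc d ^ (suc d * (2 * g))
        shrink = begin
          2 ^ (2 * g) * d ^ (suc d * (2 * g))  ≡⟨ cong (2 ^ (2 * g) *_) (^-*-assoc d (suc d) (2 * g)) ⟨
          2 ^ (2 * g) * (d ^ suc d) ^ (2 * g)  ≡⟨ ^-distribʳ-* (2 * g) 2 (d ^ suc d) ⟨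
          (2 * d ^ suc d) ^ (2 * g)            ≤⟨ ^-monoˡ-≤ (2 * g) (2*d^[1+d]≤[1+d]^[1+d] d) ⟩
          (suc d ^ suc d) ^ (2 * g)            ≡⟨ ^-*-assoc (suc d) (suc d) (2 * g) ⟩
          suc d ^ (suc d * (2 * g))            ∎

  -- Of the gain `2 ^ (2 * g)` in `shrink`, one factor `2 ^ g` cancels the weight in `few-hits-rare`
  -- and the other is the claim. A template of `4 * κ` edges keeps `2 * κ` of them available after
  -- `g ≤ κ` hits.
  no-clique-rare : ∀ P → Collectable r P → ∀ n g → Parameters r n g →
    (f : Vec (Fin n) (r * n) → ℕ) → (∀ M → f M ≤ 1) →
    (∀ M → f M ≢ 0 → Matching r M × ¬ (∃ λ S → IsCliqueIn P M S × g ≤ ∣ S ∣)) →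
    ∑ (allVecs (r * n) n) f * 2 ^ g ≤ matchings# r n
  no-clique-rare P collectable n g parameters f f≤1 bad
    with collectable (4 * κ) (≤-trans (s≤s (s≤s z≤n)) (*-monoʳ-≤ 4 κ≥1)) | colouring (r * (4 * κ)) (2 * ℓ) (r * n) points≤
    where open Parameters parameters
  ... | T , T-matching , forms | u , mono , u≤ =
    *-cancelʳ-≤ (F * 2 ^ g) (matchings# r n) (2 ^ g * d ^ t) {{m*n≢0 (2 ^ g) (d ^ t) {{m^n≢0 2 g}} {{m^n≢0 d t {{>-nonZero d≥1}}}}}} (begin
      F * 2 ^ g * (2 ^ g * d ^ t)          ≡⟨ lem F (2 ^ g) (d ^ t) ⟩
      F * ((2 ^ g * 2 ^ g) * d ^ t)        ≡⟨ cong (λ x → F * (x * d ^ t)) (trans (sym (^-distribˡ-+-* 2 g g)) (cong (λ x → 2 ^ (g + x)) (sym (+-identityʳ g)))) ⟩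
      F * (2 ^ (2 * g) * d ^ t)            ≤⟨ *-monoʳ-≤ F shrink ⟩
      F * suc d ^ t                        ≤⟨ rare ⟩
      matchings# r n * (2 ^ g * d ^ t)     ∎)
    where
    open Parameters parameters
    F : ℕ
    F = ∑ (allVecs (r * n) n) f
    lem : ∀ F x y → F * x * (x * y) ≡ F * ((x * x) * y)
    lem = solve-∀
    lem′ : ∀ κ → κ + (κ + 2 * κ) ≡ 4 * κ * 1
    lem′ = solve-∀
    open Template T (toMatching {M = T} T-matching) r≥1
    open Exposure ℓ κ d ℓ≥1 κ≥1 (≤-trans (m≤n*m κ 4) (m≤n*m (4 * κ) r)) dense
    rare : F * suc d ^ t ≤ matchings# r n * (2 ^ g * d ^ t)
    rare = few-hits-rare t n u (λ _ → 1) g f (*-comm r n) u≤ (λ _ → ≤-refl)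
      (begin
        g + 2 * κ                       ≤⟨ +-monoˡ-≤ (2 * κ) g≤κ ⟩
        κ + 2 * κ                       ≤⟨ m≤n+m (κ + 2 * κ) κ ⟩
        κ + (κ + 2 * κ)                 ≡⟨ lem′ κ ⟩
        4 * κ * 1                       ≡⟨ cong (_* 1) (ListP.length-tabulate {n = 4 * κ} id) ⟨
        length (allFin (4 * κ)) * 1     ≡⟨ ∑-const (allFin (4 * κ)) 1 ⟨
        ∑ (allFin (4 * κ)) (λ _ → 1)    ∎)
      room f≤1
      (λ M h → proj₁ (bad M h) , λ H → proj₂ (bad M h)
        (Hits.labels H , hits-clique T (toMatching {M = T} T-matching) r≥1 P mono forms H , Hits.size H))

-- Rational estimates

toℚᵘ-toℚ : ∀ k → toℚᵘ (toℚ k) ℚᵘ.≃ mkℚᵘ (ℤ.+ k) 0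
toℚᵘ-toℚ k = ℚP.toℚᵘ-fromℚᵘ (mkℚᵘ (ℤ.+ k) 0)

toℚ-mono : ∀ {a b} → a ≤ b → toℚ a ≤ℚ toℚ b
toℚ-mono {a} {b} h = ℚP.toℚᵘ-cancel-≤ (ℚᵘP.≤-respʳ-≃ (ℚᵘP.≃-sym (toℚᵘ-toℚ b))
  (ℚᵘP.≤-respˡ-≃ (ℚᵘP.≃-sym (toℚᵘ-toℚ a)) (*≤* (ℤP.*-monoʳ-≤-nonNeg (ℤ.+ 1) (ℤ.+≤+ h)))))

toℚ-* : ∀ a b → toℚ (a * b) ≡ toℚ a *ℚ toℚ b
toℚ-* a b = ℚP.toℚᵘ-injective (ℚᵘP.≃-trans (toℚᵘ-toℚ (a * b)) (ℚᵘP.≃-trans (*≡* (cong (ℤ._* ℤ.+ 1) (ℤP.pos-* a b)))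
  (ℚᵘP.≃-sym (ℚᵘP.≃-trans (ℚP.toℚᵘ-homo-* (toℚ a) (toℚ b)) (ℚᵘP.*-cong (toℚᵘ-toℚ a) (toℚᵘ-toℚ b))))))

toℚ-+ : ∀ a b → toℚ (a + b) ≡ toℚ a +ℚ toℚ b
toℚ-+ a b = ℚP.toℚᵘ-injective (ℚᵘP.≃-trans (toℚᵘ-toℚ (a + b))
  (ℚᵘP.≃-trans (*≡* (cong (ℤ._* ℤ.+ 1) (cong₂ ℤ._+_ (sym (ℤP.*-identityʳ (ℤ.+ a))) (sym (ℤP.*-identityʳ (ℤ.+ b))))))
  (ℚᵘP.≃-sym (ℚᵘP.≃-trans (ℚP.toℚᵘ-homo-+ (toℚ a) (toℚ b)) (ℚᵘP.+-cong (toℚᵘ-toℚ a) (toℚᵘ-toℚ b))))))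

toℚ-^ : ∀ a k → toℚ (a ^ k) ≡ toℚ a ^ℚ k
toℚ-^ a zero    = refl
toℚ-^ a (suc k) = trans (toℚ-* a (a ^ k)) (cong (toℚ a *ℚ_) (toℚ-^ a k))

^ℚ-distribʳ-* : ∀ k p q → (p *ℚ q) ^ℚ k ≡ (p ^ℚ k) *ℚ (q ^ℚ k)
^ℚ-distribʳ-* zero    p q = refl
^ℚ-distribʳ-* (suc k) p q = trans (cong ((p *ℚ q) *ℚ_) (^ℚ-distribʳ-* k p q)) (*ℚ-interchange p q (p ^ℚ k) (q ^ℚ k))

1^ℚ : ∀ k → 1ℚ ^ℚ k ≡ 1ℚ
1^ℚ zero    = refl
1^ℚ (suc k) = trans (ℚP.*-identityˡ _) (1^ℚ k)

^ℚ-nonNeg : ∀ p → 0ℚ ≤ℚ p → ∀ k → 0ℚ ≤ℚ p ^ℚ k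
^ℚ-nonNeg p h zero    = ℚP.nonNegative⁻¹ 1ℚ
^ℚ-nonNeg p h (suc k) = ℚP.≤-trans (ℚP.≤-reflexive (sym (ℚP.*-zeroʳ p)))
  (ℚP.*-monoˡ-≤-nonNeg p {{ℚ.nonNegative h}} (^ℚ-nonNeg p h k))

-- The numerator of a positive rational is at least 1. Hence the denominator of `ε` can serve as an
-- integer accuracy `q`.
1≤ε*↧ε : ∀ ε → 0ℚ <ℚ ε → 1ℚ ≤ℚ ε *ℚ toℚ (↧ₙ ε)
1≤ε*↧ε ε@(mkℚ n d-1 _) ε>0 = positive-numerator n refl (ℚ.positive ε>0)
  where
  positive-numerator : ∀ m → n ≡ m → ℚ.Positive ε → 1ℚ ≤ℚ ε *ℚ toℚ (↧ₙ ε)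
  positive-numerator (ℤ.+ zero)  refl ()
  positive-numerator ℤ.-[1+ _ ] refl ()
  positive-numerator +[1+ p ]  refl _ = ℚP.toℚᵘ-cancel-≤ (ℚᵘP.≤-respʳ-≃
    (ℚᵘP.≃-sym (ℚᵘP.≃-trans (ℚP.toℚᵘ-homo-* ε (toℚ (suc d-1))) (ℚᵘP.*-cong {mkℚᵘ +[1+ p ] d-1} ℚᵘP.≃-refl (toℚᵘ-toℚ (suc d-1)))))
    (*≤* (ℤ.+≤+ (begin
      1 * (suc d-1 * 1)        ≡⟨ *-identityˡ (suc d-1 * 1) ⟩
      suc d-1 * 1              ≡⟨ *-identityʳ (suc d-1) ⟩
      suc d-1                  ≤⟨ m≤n*m (suc d-1) (suc p) ⟩
      suc p * suc d-1          ≡⟨ *-identityʳ (suc p * suc d-1) ⟨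
      suc p * suc d-1 * 1      ∎))))
    where open ≤-Reasoning

1-ε-bound : ∀ ε → 0ℚ <ℚ ε → ∀ T G E → T ≤ G + E → E * (↧ₙ ε) ≤ T → (1ℚ - ε) *ℚ toℚ T ≤ℚ toℚ G
1-ε-bound ε ε>0 T G E T≤ E≤ = begin
  (1ℚ - ε) *ℚ toℚ T                          ≡⟨ ℚP.*-distribʳ-+ (toℚ T) 1ℚ (ℚ.- ε) ⟩
  1ℚ *ℚ toℚ T +ℚ (ℚ.- ε) *ℚ toℚ T            ≡⟨ cong₂ _+ℚ_ (ℚP.*-identityˡ (toℚ T)) (sym (ℚP.neg-distribˡ-* ε (toℚ T))) ⟩
  toℚ T - ε *ℚ toℚ T                         ≤⟨ ℚP.+-monoˡ-≤ (ℚ.- (ε *ℚ toℚ T)) T≤G+εT ⟩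
  toℚ G +ℚ ε *ℚ toℚ T - ε *ℚ toℚ T           ≡⟨ ℚP.+-assoc (toℚ G) (ε *ℚ toℚ T) (ℚ.- (ε *ℚ toℚ T)) ⟩
  toℚ G +ℚ (ε *ℚ toℚ T - ε *ℚ toℚ T)         ≡⟨ cong (toℚ G +ℚ_) (ℚP.+-inverseʳ (ε *ℚ toℚ T)) ⟩
  toℚ G +ℚ 0ℚ                                ≡⟨ ℚP.+-identityʳ (toℚ G) ⟩
  toℚ G                                      ∎
  where
  open ℚP.≤-Reasoning
  instance
    ε≥0 : ℚ.NonNegative ε
    ε≥0 = ℚ.nonNegative (ℚP.<⇒≤ ε>0)
    E≥0 : ℚ.NonNegative (toℚ E)
    E≥0 = ℚ.nonNegative (toℚ-mono {0} {E} z≤n)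
  E≤εT : toℚ E ≤ℚ ε *ℚ toℚ T
  E≤εT = begin
    toℚ E                            ≡⟨ ℚP.*-identityˡ (toℚ E) ⟨
    1ℚ *ℚ toℚ E                      ≤⟨ ℚP.*-monoʳ-≤-nonNeg (toℚ E) (1≤ε*↧ε ε ε>0) ⟩
    ε *ℚ toℚ (↧ₙ ε) *ℚ toℚ E         ≡⟨ ℚP.*-assoc ε (toℚ (↧ₙ ε)) (toℚ E) ⟩
    ε *ℚ (toℚ (↧ₙ ε) *ℚ toℚ E)       ≡⟨ cong (ε *ℚ_) (sym (toℚ-* (↧ₙ ε) E)) ⟩
    ε *ℚ toℚ ((↧ₙ ε) * E)            ≤⟨ ℚP.*-monoˡ-≤-nonNeg ε (toℚ-mono (≤-trans (≤-reflexive (*-comm (↧ₙ ε) E)) E≤)) ⟩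
    ε *ℚ toℚ T                       ∎
  T≤G+εT : toℚ T ≤ℚ toℚ G +ℚ ε *ℚ toℚ T
  T≤G+εT = begin
    toℚ T                    ≤⟨ toℚ-mono T≤ ⟩
    toℚ (G + E)              ≡⟨ toℚ-+ G E ⟩
    toℚ G +ℚ toℚ E           ≤⟨ ℚP.+-monoʳ-≤ (toℚ G) E≤εT ⟩
    toℚ G +ℚ ε *ℚ toℚ T      ∎

-- Combining the two bounds.

m≤2^m : ∀ m → m ≤ 2 ^ m
m≤2^m zero    = z≤n
m≤2^m (suc m) = begin
  suc m               ≤⟨ +-mono-≤ (m^n>0 2 m) (m≤2^m m) ⟩
  2 ^ m + 2 ^ m       ≡⟨ cong (2 ^ m +_) (+-identityʳ (2 ^ m)) ⟨
  2 ^ suc m           ∎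
  where open ≤-Reasoning

-- The threshold on `n` makes both `g` and `suc k` at least `2 * q`, so that each of the error terms
-- `2 ^ (- g)` and `2 ^ (- suc k)` is at most `1 / (2 * q)`.
root-sizes : ∀ {r Q B} → 1 ≤ r → 1 ≤ Q → 1 ≤ B → ∀ q → 1 ≤ q → ∀ n → (Q * suc (2 * q)) ^ r ≤ n →
  1 ≤ n ×
  (∃ λ g → 1 ≤ g × (Q * g) ^ r ≤ n × n < (Q * suc g) ^ r × 2 * q ≤ g) ×
  (∃ λ k → k ^ r ≤ B ^ r * n × B ^ r * n < suc k ^ r × 2 * q ≤ suc k)
root-sizes {r} {Q} {B} r≥1 Q≥1 B≥1 q q≥1 n N≤n
  with crossing (λ g → (Q * g) ^ r) n (suc n)
         (≤-trans (≤-reflexive (trans (cong (_^ r) (*-zeroʳ Q)) (0^r))) z≤n)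
         (≤-trans (m≤n*m (suc n) Q {{>-nonZero Q≥1}}) (m≤m^n (Q * suc n) r r≥1))
     | crossing (λ k → k ^ r) (B ^ r * n) (suc (B ^ r * n)) (≤-trans (≤-reflexive 0^r) z≤n) (m≤m^n (suc (B ^ r * n)) r r≥1)
  where
  0^r : 0 ^ r ≡ 0
  0^r = cong (0 ^_) (sym (m+[n∸m]≡n r≥1))
... | g , g-lo , g-hi | k , k-lo , k-hi =
  ≤-trans (s≤s z≤n) 1+2q≤n ,
  (g , ≤-trans q≥1 (≤-trans (m≤n*m q 2) 2q≤g) , g-lo , g-hi , 2q≤g) ,
  (k , k-lo , k-hi , <⇒≤ 2q<1+k)
  where
  open ≤-Reasoning
  1+2q≤Q[1+2q] : suc (2 * q) ≤ Q * suc (2 * q)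
  1+2q≤Q[1+2q] = m≤n*m (suc (2 * q)) Q {{>-nonZero Q≥1}}
  1+2q≤n : suc (2 * q) ≤ n
  1+2q≤n = ≤-trans 1+2q≤Q[1+2q] (≤-trans (m≤m^n _ r r≥1) N≤n)
  2q≤g : 2 * q ≤ g
  2q≤g = <⇒≤ (s≤s⁻¹ (*-cancelˡ-< Q (suc (2 * q)) (suc g) (^-cancelˡ-< r (≤-<-trans N≤n g-hi))))
  2q<1+k : 2 * q < suc k
  2q<1+k = ^-cancelˡ-< r (≤-<-trans (begin
    (2 * q) ^ r              ≤⟨ ^-monoˡ-≤ r (≤-trans (n≤1+n (2 * q)) 1+2q≤Q[1+2q]) ⟩
    (Q * suc (2 * q)) ^ r    ≤⟨ N≤n ⟩
    n                        ≤⟨ m≤n*m n (B ^ r) {{m^n≢0 B r {{>-nonZero B≥1}}}} ⟩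
    B ^ r * n                ∎) k-hi)

module _ (r : ℕ) (r≥2 : 2 ≤ r) where

  private
    r≥1 : 1 ≤ r
    r≥1 = ≤-trans (s≤s z≤n) r≥2
    instance
      r≢0 : NonZero r
      r≢0 = >-nonZero r≥1

  scale≥1 : 1 ≤ scale r
  scale≥1 = ≤-trans (≤-trans r≥1 (m≤n*m r 128)) (scale≥128r r≥2)

  2scale≥1 : 1 ≤ 2 * scale r
  2scale≥1 = ≤-trans scale≥1 (m≤n*m (scale r) 2)

  2scale-positive : ℚ.Positive (toℚ (2 * scale r))
  2scale-positive = ℚ.positive (ℚP.<-≤-trans (ℚP.positive⁻¹ 1ℚ) (toℚ-mono {1} 2scale≥1))

  2scale-nonZero : ℚ.NonZero (toℚ (2 * scale r))
  2scale-nonZero = ℚP.pos⇒nonZero (toℚ (2 * scale r)) {{2scale-positive}}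

  -- Rounding the root down to an integer `g ≥ 1` costs at most a factor 2, which is the 2 in
  -- `lower`.
  lower upper : ℚ
  lower = (1/ toℚ (2 * scale r)) {{2scale-nonZero}}
  upper = toℚ 16

  lower>0 : 0ℚ <ℚ lower
  lower>0 = ℚP.positive⁻¹ lower {{ℚP.1/pos⇒pos (toℚ (2 * scale r)) {{2scale-positive}}}}

  lower-inverse : lower *ℚ toℚ (2 * scale r) ≡ 1ℚ
  lower-inverse = ℚP.*-inverseˡ (toℚ (2 * scale r)) {{2scale-nonZero}}

  lower≤upper : lower ≤ℚ upper
  lower≤upper = ℚP.≤-trans (begin
    lower                               ≡⟨ ℚP.*-identityʳ lower ⟨
    lower *ℚ 1ℚ                         ≤⟨ ℚP.*-monoˡ-≤-nonNeg lower {{ℚ.nonNegative (ℚP.<⇒≤ lower>0)}} (toℚ-mono {1} 2scale≥1) ⟩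
    lower *ℚ toℚ (2 * scale r)          ≡⟨ lower-inverse ⟩
    1ℚ                                  ∎) (toℚ-mono {1} {16} (s≤s z≤n))
    where open ℚP.≤-Reasoning

  lower-bound : ∀ n s → n ≤ (2 * scale r * s) ^ r → (lower ^ℚ r) *ℚ toℚ n ≤ℚ toℚ s ^ℚ r
  lower-bound n s h = begin
    (lower ^ℚ r) *ℚ toℚ n                              ≤⟨ ℚP.*-monoˡ-≤-nonNeg (lower ^ℚ r)
      {{ℚ.nonNegative (^ℚ-nonNeg lower (ℚP.<⇒≤ lower>0) r)}} (toℚ-mono h) ⟩
    (lower ^ℚ r) *ℚ toℚ ((2 * scale r * s) ^ r)        ≡⟨ cong ((lower ^ℚ r) *ℚ_) (trans (toℚ-^ (2 * scale r * s) r)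
                                                            (cong (_^ℚ r) (toℚ-* (2 * scale r) s))) ⟩
    (lower ^ℚ r) *ℚ ((X *ℚ toℚ s) ^ℚ r)                ≡⟨ ^ℚ-distribʳ-* r lower (X *ℚ toℚ s) ⟨
    (lower *ℚ (X *ℚ toℚ s)) ^ℚ r                       ≡⟨ cong (_^ℚ r) (trans (sym (ℚP.*-assoc lower X (toℚ s)))
                                                            (trans (cong (_*ℚ toℚ s) lower-inverse) (ℚP.*-identityˡ (toℚ s)))) ⟩
    toℚ s ^ℚ r                                         ∎
    where
    open ℚP.≤-Reasoning
    X : ℚ
    X = toℚ (2 * scale r)

  upper-bound : ∀ n s → s ^ r ≤ 16 ^ r * n → toℚ s ^ℚ r ≤ℚ (upper ^ℚ r) *ℚ toℚ n
  upper-bound n s h = begin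
    toℚ s ^ℚ r                       ≡⟨ toℚ-^ s r ⟨
    toℚ (s ^ r)                      ≤⟨ toℚ-mono h ⟩
    toℚ (16 ^ r * n)                 ≡⟨ trans (toℚ-* (16 ^ r) n) (cong (_*ℚ toℚ n) (toℚ-^ 16 r)) ⟩
    (upper ^ℚ r) *ℚ toℚ n            ∎
    where open ℚP.≤-Reasoning

  module _ (P : List Bool) (P-pattern : IsRPattern r P) (collectable : Collectable r P) where

    HasClique : ∀ {n m} → ℕ → Vec (Fin n) m → Set
    HasClique g M = ∃ λ S → IsCliqueIn P M S × g ≤ ∣ S ∣

    hasClique? : ∀ {n m} g (M : Vec (Fin n) m) → Dec (HasClique g M)
    hasClique? g M = anySubset? (λ S → isCliqueIn? P M S ×-dec (g ≤? ∣ S ∣))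

    -- The exceptions are matchings without a clique of size `g` and matchings with one of size
    -- `suc k`. The integer root leaves no gap: size `k` still obeys the upper bound, and `suc k` is
    -- already large enough for `large-cliques-rare`.
    good-concentration : ∀ n g k → 1 ≤ n → 1 ≤ g → (scale r * g) ^ r ≤ n → n < (scale r * suc g) ^ r →
      k ^ r ≤ 16 ^ r * n → 16 ^ r * n < suc k ^ r → ∀ q → 2 * q ≤ 2 ^ g → 2 * q ≤ 2 ^ suc k →
      ∃ λ E → numMatchings r n ≤ numGood r n P lower upper + E × E * q ≤ numMatchings r n
    good-concentration n g k n≥1 g≥1 g-lo g-hi k-lo k-hi q q≤g q≤k = F₁ + F₂ , split , small
      where
      open ≤-Reasoning
      vecs : List (Vec (Fin n) (r * n))
      vecs = allVecs (r * n) n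
      noSmall? : ∀ M → Dec (IsMatching r n M × ¬ HasClique g M)
      noSmall? M = isMatching? r n M ×-dec ¬? (hasClique? g M)
      large? : ∀ M → Dec (IsMatching r n M × HasClique (suc k) M)
      large? M = isMatching? r n M ×-dec hasClique? (suc k) M
      good′? : ∀ M → Dec (IsMatching r n M × Good r n P lower upper M)
      good′? M = isMatching? r n M ×-dec good? r n P lower upper M
      F₁ F₂ : ℕ
      F₁ = ∑ vecs (λ M → ind (noSmall? M))
      F₂ = ∑ vecs (λ M → ind (large? M))

      n≤ : ∀ s → g ≤ s → n ≤ (2 * scale r * s) ^ r
      n≤ s g≤s = ≤-trans (<⇒≤ g-hi) (^-monoˡ-≤ r (begin
        scale r * suc g         ≤⟨ *-monoʳ-≤ (scale r) (+-mono-≤ g≥1 (≤-reflexive (sym (+-identityʳ g)))) ⟩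
        scale r * (2 * g)       ≡⟨ lem (scale r) g ⟩
        2 * scale r * g         ≤⟨ *-monoʳ-≤ (2 * scale r) g≤s ⟩
        2 * scale r * s         ∎))
        where
        lem : ∀ x g → x * (2 * g) ≡ 2 * x * g
        lem = solve-∀

      good-unless : ∀ M → HasClique g M → ¬ HasClique (suc k) M → Good r n P lower upper M
      good-unless M (S , clique , g≤) ¬large =
        (S , clique , lower-bound n ∣ S ∣ (n≤ ∣ S ∣ g≤)) ,
        λ S′ clique′ → upper-bound n ∣ S′ ∣
          (≤-trans (^-monoˡ-≤ r (≮⇒≥ (λ k<S → ¬large (S′ , clique′ , k<S)))) k-lo)

      cover : ∀ M → ind (isMatching? r n M) ≤ ind (good′? M) + (ind (noSmall? M) + ind (large? M))
      cover M = by-cases (isMatching? r n M) (hasClique? g M) (hasClique? (suc k) M)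
        where
        by-cases : (d : Dec (IsMatching r n M)) → Dec (HasClique g M) → Dec (HasClique (suc k) M) →
          ind d ≤ ind (good′? M) + (ind (noSmall? M) + ind (large? M))
        by-cases (no _)  _       _       = z≤n
        by-cases (yes h) (no ¬s) _       = ≤-trans (≤-reflexive (sym (ind-yes (noSmall? M) (h , ¬s))))
                                             (≤-trans (m≤m+n _ (ind (large? M))) (m≤n+m _ (ind (good′? M))))
        by-cases (yes h) (yes s) (yes l) = ≤-trans (≤-reflexive (sym (ind-yes (large? M) (h , l))))
                                             (≤-trans (m≤n+m _ (ind (noSmall? M))) (m≤n+m _ (ind (good′? M))))
        by-cases (yes h) (yes s) (no ¬l) = ≤-trans (≤-reflexive (sym (ind-yes (good′? M) (h , good-unless M s ¬l)))) (m≤m+n _ _)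

      split : numMatchings r n ≤ numGood r n P lower upper + (F₁ + F₂)
      split = begin
        numMatchings r n
          ≡⟨ length-filter (isMatching? r n) vecs ⟩
        ∑ vecs (λ M → ind (isMatching? r n M))
          ≤⟨ ∑-mono vecs cover ⟩
        ∑ vecs (λ M → ind (good′? M) + (ind (noSmall? M) + ind (large? M)))
          ≡⟨ trans (∑-+ vecs _ _) (cong (∑ vecs (λ M → ind (good′? M)) +_) (∑-+ vecs _ _)) ⟩
        ∑ vecs (λ M → ind (good′? M)) + (F₁ + F₂)
          ≡⟨ cong (_+ (F₁ + F₂)) (length-filter good′? vecs) ⟨
        numGood r n P lower upper + (F₁ + F₂) ∎

      F₁-small : F₁ * 2 ^ g ≤ matchings# r n
      F₁-small = no-clique-rare r≥2 P collectable n g (parameters r≥2 n g g≥1 g-lo) (λ M → ind (noSmall? M))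
        (λ M → ind≤1 (noSmall? M)) (λ M h → map (toMatching {M = M}) id (ind≢0 (noSmall? M) h))

      F₂-small : F₂ * 2 ^ suc k ≤ matchings# r n
      F₂-small = large-cliques-rare r≥1 P P-pattern n (suc k) (λ M → ind (large? M)) (*-comm r n) n≥1 (<⇒≤ k-hi)
        (λ M → ind≤1 (large? M)) (λ M h → map (toMatching {M = M}) id (ind≢0 (large? M) h))

      small : (F₁ + F₂) * q ≤ numMatchings r n
      small = *-cancelˡ-≤ 2 (begin
        2 * ((F₁ + F₂) * q)                  ≡⟨ lem F₁ F₂ q ⟩
        F₁ * (2 * q) + F₂ * (2 * q)          ≤⟨ +-mono-≤ (≤-trans (*-monoʳ-≤ F₁ q≤g) F₁-small) (≤-trans (*-monoʳ-≤ F₂ q≤k) F₂-small) ⟩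
        matchings# r n + matchings# r n      ≡⟨ cong (matchings# r n +_) (+-identityʳ (matchings# r n)) ⟨
        2 * matchings# r n                   ≡⟨ cong (2 *_) (numMatchings≡ r n) ⟨
        2 * numMatchings r n                 ∎)
        where
        lem : ∀ a b q → 2 * ((a + b) * q) ≡ a * (2 * q) + b * (2 * q)
        lem = solve-∀

    good-likely : ∀ ε → 0ℚ <ℚ ε → Σ ℕ λ N → (n : ℕ) → N ≤ n →
      (1ℚ - ε) *ℚ toℚ (numMatchings r n) ≤ℚ toℚ (numGood r n P lower upper)
    good-likely ε ε>0 = (scale r * suc (2 * q)) ^ r ,
      λ n N≤n → conclude n (root-sizes {r} {scale r} {16} r≥1 scale≥1 (s≤s z≤n) q (s≤s z≤n) n N≤n)
      where
      q : ℕ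
      q = ↧ₙ ε
      conclude : ∀ n →
        1 ≤ n ×
        (∃ λ g → 1 ≤ g × (scale r * g) ^ r ≤ n × n < (scale r * suc g) ^ r × 2 * q ≤ g) ×
        (∃ λ k → k ^ r ≤ 16 ^ r * n × 16 ^ r * n < suc k ^ r × 2 * q ≤ suc k) →
        (1ℚ - ε) *ℚ toℚ (numMatchings r n) ≤ℚ toℚ (numGood r n P lower upper)
      conclude n (n≥1 , (g , g≥1 , g-lo , g-hi , 2q≤g) , (k , k-lo , k-hi , 2q≤k)) =
        let E , T≤ , E≤ = good-concentration n g k n≥1 g≥1 g-lo g-hi k-lo k-hi q
                            (≤-trans 2q≤g (m≤2^m g)) (≤-trans 2q≤k (m≤2^m (suc k)))
        in 1-ε-bound ε ε>0 (numMatchings r n) (numGood r n P lower upper) E T≤ E≤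

theorem1p8 : (r : ℕ) → 2 ≤ r →
    Σ ℚ λ c → Σ ℚ λ C → (0ℚ <ℚ c) × (c ≤ℚ C) ×
    ((P : List Bool) → IsRPattern r P → Collectable r P →
    (ε : ℚ) → 0ℚ <ℚ ε →
    Σ ℕ λ N → (n : ℕ) → N ≤ n →
    (1ℚ - ε) *ℚ toℚ (numMatchings r n) ≤ℚ toℚ (numGood r n P c C))
theorem1p8 r r≥2 = lower r r≥2 , upper r r≥2 , lower>0 r r≥2 , lower≤upper r r≥2 , good-likely r r≥2
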